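{- For every integer $n\geqslant 0$, $$ b(n) = \sum_{k=0}^{\infty} S\big(n/2-k(k+1)/4 \big), $$ where $S(x)=0$ if $x$ is not a positive integer.
   Context: For a nonnegative integer $n$, $b(n)$ is the total number of parts in all the partitions of $n$ into odd parts minus the total number of parts in all the partitions of $n$ into distinct parts (parts counted with multiplicity); thus $b(0)=0$. For a positive integer $n$, $S(n)$ is the total number of parts (counted with multiplicity) in all the partitions of $n$; for example $S(5)=1+2+2+3+3+4+5=20$. For any rational $x$ that is not a positive integer, $S(x)=0$. -}

module Defs where

open import Data.Integer.Base as ℤ using (ℤ; +_; 0ℤ)
open import Data.List.Base using (List; []; _∷_; _++_; map; concatMap; filter; foldr; length; replicate; upTo; applyUpTo)
open import Data.List.Membership.Propositional using (_∈_; find; lose)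
open import Data.List.Membership.Propositional.Properties using (∈-map⁺; ∈-map⁻; ∈-filter⁺; ∈-filter⁻; ∈-upTo⁺; ∈-concatMap⁺; ∈-concatMap⁻)
open import Data.List.Properties using (++-cancelˡ; ∷-injectiveʳ)
open import Data.List.Relation.Unary.All as All using (All; []; _∷_; all?)
import Data.List.Relation.Unary.All.Properties as Allₚ
open import Data.List.Relation.Unary.AllPairs as AllPairs using (AllPairs; []; _∷_)
import Data.List.Relation.Unary.AllPairs.Properties as AllPairsₚ
open import Data.List.Relation.Unary.Any using (here)
open import Data.List.Relation.Binary.Disjoint.Propositional using (Disjoint)
open import Data.List.Relation.Unary.Unique.Propositional using (Unique)
import Data.List.Relation.Unary.Unique.Propositional.Properties as Uniqueₚ
open import Data.Nat.Base using (ℕ; zero; suc; _+_; _*_; _∸_; _≤_; _<_; _≥_; s≤s; z<s)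
open import Data.Nat.Divisibility using (_∣_; _∣?_)
open import Data.Nat.ListAction using (sum)
open import Data.Nat.Properties
open import Data.List.Relation.Unary.Unique.DecPropositional _≟_ using (unique?)
open import Data.Product.Base using (∃-syntax; _×_; _,_; proj₁; proj₂)
open import Data.Rational.Base using (ℚ; mkℚ)
open import Function.Base using (_∘_)
open import Function.Bundles using (_⇔_; mk⇔)
open import Relation.Binary.PropositionalEquality
open import Relation.Nullary using (¬_; ¬?; yes; no; contradiction)
open import Relation.Unary using (Decidable)

record IsPartition (n : ℕ) (ps : List ℕ) : Set where
  constructor isPartition
  field
    positive      : All (0 <_) ps
    nonincreasing : AllPairs _≥_ ps
    sums          : sum ps ≡ n

-- The partitions of n with all parts ≤ m. In the last clause, j is the
-- multiplicity of the part suc m.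
partitionsUpTo : ℕ → ℕ → List (List ℕ)
partitionsUpTo zero    zero    = [] ∷ []
partitionsUpTo zero    (suc _) = []
partitionsUpTo (suc m) n       =
  concatMap (λ j → map (replicate j (suc m) ++_) (partitionsUpTo m (n ∸ j * suc m)))
            (filter (λ j → j * suc m ≤? n) (upTo (suc n)))

partitions : ℕ → List (List ℕ)
partitions n = partitionsUpTo n n

------------------------------------------------------------------------
-- `partitions n` lists every partition of n exactly once.

module _ (m : ℕ) where

  split : ∀ ps → All (0 <_) ps → AllPairs _≥_ ps → All (_≤ suc m) ps →
          ∃[ j ] ∃[ qs ] ps ≡ replicate j (suc m) ++ qs
            × All (0 <_) qs × AllPairs _≥_ qs × All (_≤ m) qs
  split []       _          _          _          = 0 , [] , refl , [] , [] , []
  split (p ∷ ps) (0<p ∷ ps>0) (p≥ ∷ ps≥) (p≤ ∷ ps≤) with p ≟ suc m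
  ... | yes refl = let j , qs , eq , rest = split ps ps>0 ps≥ ps≤ in
                   suc j , qs , cong (suc m ∷_) eq , rest
  ... | no  p≢   = let p≤m = ≤-pred (≤∧≢⇒< p≤ p≢) in
                   0 , p ∷ ps , refl , 0<p ∷ ps>0 , p≥ ∷ ps≥ ,
                   p≤m ∷ All.map (λ q≤p → ≤-trans q≤p p≤m) p≥

  sum-replicate-++ : ∀ j qs → sum (replicate j (suc m) ++ qs) ≡ j * suc m + sum qs
  sum-replicate-++ zero    qs = refl
  sum-replicate-++ (suc j) qs =
    trans (cong (_+_ (suc m)) (sum-replicate-++ j qs)) (sym (+-assoc (suc m) (j * suc m) (sum qs)))

  replicate-++-injectiveˡ : ∀ i j {ps qs} → All (_≤ m) ps → All (_≤ m) qs →
    replicate i (suc m) ++ ps ≡ replicate j (suc m) ++ qs → i ≡ j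
  replicate-++-injectiveˡ zero    zero    _         _         _    = refl
  replicate-++-injectiveˡ zero    (suc j) (p≤m ∷ _) _         refl = contradiction p≤m 1+n≰n
  replicate-++-injectiveˡ (suc i) zero    _         (q≤m ∷ _) refl = contradiction q≤m 1+n≰n
  replicate-++-injectiveˡ (suc i) (suc j) ps≤       qs≤       eq   =
    cong suc (replicate-++-injectiveˡ i j ps≤ qs≤ (∷-injectiveʳ eq))

nonincreasing-++ : ∀ m j {qs} → AllPairs _≥_ qs → All (_≤ m) qs →
                   AllPairs _≥_ (replicate j (suc m) ++ qs)
nonincreasing-++ m zero    qs≥ _   = qs≥
nonincreasing-++ m (suc j) qs≥ qs≤ =
  Allₚ.++⁺ (Allₚ.replicate⁺ j ≤-refl) (All.map m≤n⇒m≤1+n qs≤) ∷ nonincreasing-++ m j qs≥ qs≤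

partitionsUpTo-sound : ∀ m n {ps} → ps ∈ partitionsUpTo m n → IsPartition n ps × All (_≤ m) ps
partitionsUpTo-sound zero    zero    (here refl) = isPartition [] [] refl , []
partitionsUpTo-sound (suc m) n       ps∈
  with j , j∈ , ps∈′ ← find (∈-concatMap⁻ (λ j → map (replicate j (suc m) ++_) (partitionsUpTo m (n ∸ j * suc m))) ps∈)
  with qs , qs∈ , refl ← ∈-map⁻ (replicate j (suc m) ++_) ps∈′
  with isPartition qs>0 qs≥ Σqs , qs≤ ← partitionsUpTo-sound m (n ∸ j * suc m) qs∈
  = isPartition
      (Allₚ.++⁺ (Allₚ.replicate⁺ j z<s) qs>0)
      (nonincreasing-++ m j qs≥ qs≤)
      (trans (sum-replicate-++ m j qs)
             (trans (cong (_+_ (j * suc m)) Σqs)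
                    (m+[n∸m]≡n (proj₂ (∈-filter⁻ (λ j → j * suc m ≤? n) {xs = upTo (suc n)} j∈)))))
  , Allₚ.++⁺ (Allₚ.replicate⁺ j ≤-refl) (All.map m≤n⇒m≤1+n qs≤)

partitionsUpTo-complete : ∀ m n {ps} → IsPartition n ps → All (_≤ m) ps → ps ∈ partitionsUpTo m n
partitionsUpTo-complete zero _ {[]}    (isPartition _ _ refl)      _          = here refl
partitionsUpTo-complete zero _ {_ ∷ _} (isPartition (0<p ∷ _) _ _) (p≤0 ∷ _) = contradiction p≤0 (<⇒≱ 0<p)
partitionsUpTo-complete (suc m) n {ps} (isPartition ps>0 ps≥ Σps) ps≤
  with j , qs , refl , qs>0 , qs≥ , qs≤ ← split m ps ps>0 ps≥ ps≤
  = ∈-concatMap⁺ _ (lose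
      (∈-filter⁺ (λ j → j * suc m ≤? n) (∈-upTo⁺ (s≤s (≤-trans (m≤m*n j (suc m)) jm≤n))) jm≤n)
      (∈-map⁺ _ (partitionsUpTo-complete m (n ∸ j * suc m) (isPartition qs>0 qs≥ Σqs) qs≤)))
  where
  Σ≡n : j * suc m + sum qs ≡ n
  Σ≡n = trans (sym (sum-replicate-++ m j qs)) Σps
  jm≤n : j * suc m ≤ n
  jm≤n = subst (j * suc m ≤_) Σ≡n (m≤m+n (j * suc m) (sum qs))
  Σqs : sum qs ≡ n ∸ j * suc m
  Σqs = trans (sym (m+n∸m≡n (j * suc m) (sum qs))) (cong (_∸ j * suc m) Σ≡n)

partitionsUpTo-unique : ∀ m n → Unique (partitionsUpTo m n)
partitionsUpTo-unique zero    zero    = [] ∷ []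
partitionsUpTo-unique zero    (suc n) = []
partitionsUpTo-unique (suc m) n       = Uniqueₚ.concat⁺
  (Allₚ.map⁺ (All.universal
    (λ j → Uniqueₚ.map⁺ (λ {xs} {ys} → ++-cancelˡ (replicate j (suc m)) xs ys) (partitionsUpTo-unique m (n ∸ j * suc m))) _))
  (AllPairsₚ.map⁺ (AllPairs.map (λ {i} {j} → disjoint i j)
    (Uniqueₚ.filter⁺ (λ j → j * suc m ≤? n) (Uniqueₚ.upTo⁺ (suc n)))))
  where
  block : ℕ → List (List ℕ)
  block j = map (replicate j (suc m) ++_) (partitionsUpTo m (n ∸ j * suc m))
  disjoint : ∀ i j → i ≢ j → Disjoint (block i) (block j)
  disjoint i j i≢j (ps∈ , ps∈′)
    with qs , qs∈ , eq  ← ∈-map⁻ (replicate i (suc m) ++_) ps∈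
    with rs , rs∈ , eq′ ← ∈-map⁻ (replicate j (suc m) ++_) ps∈′
    = i≢j (replicate-++-injectiveˡ m i j
             (proj₂ (partitionsUpTo-sound m _ qs∈)) (proj₂ (partitionsUpTo-sound m _ rs∈)) (trans (sym eq) eq′))

parts≤sum : ∀ ps → All (_≤ sum ps) ps
parts≤sum []       = []
parts≤sum (p ∷ ps) = m≤m+n p (sum ps) ∷ All.map (λ q≤ → ≤-trans q≤ (m≤n+m (sum ps) p)) (parts≤sum ps)

∈-partitions : ∀ {n ps} → ps ∈ partitions n ⇔ IsPartition n ps
∈-partitions {n} = mk⇔ (proj₁ ∘ partitionsUpTo-sound n n)
  λ { p@(isPartition _ _ refl) → partitionsUpTo-complete n n p (parts≤sum _) }

partitions-unique : ∀ n → Unique (partitions n)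
partitions-unique n = partitionsUpTo-unique n n

------------------------------------------------------------------------

Odd : ℕ → Set
Odd k = ¬ 2 ∣ k

odd? : Decidable Odd
odd? k = ¬? (2 ∣? k)

oddPartitions : ℕ → List (List ℕ)
oddPartitions = filter (all? odd?) ∘ partitions

distinctPartitions : ℕ → List (List ℕ)
distinctPartitions = filter unique? ∘ partitions

totalParts : List (List ℕ) → ℕ
totalParts = sum ∘ map length

b : ℕ → ℤ
b n = + totalParts (oddPartitions n) ℤ.- + totalParts (distinctPartitions n)

-- A rational is stored in lowest terms as a numerator and the predecessor of
-- its denominator, so the first clause covers exactly the positive integers.
S : ℚ → ℕ
S (mkℚ (+ suc n) 0 _) = totalParts (partitions (suc n))
S _                   = 0

partialSum : (ℕ → ℤ) → ℕ → ℤ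
partialSum f M = foldr ℤ._+_ 0ℤ (applyUpTo f M)

-- ∑_{k ≥ 0} f k = s. For integer terms, convergence means that the partial
-- sums are eventually equal to s.
HasSum : (ℕ → ℤ) → ℤ → Set
HasSum f s = ∃[ N ] ∀ M → N ≤ M → partialSum f M ≡ s

{-# OPTIONS --safe #-}

-- With g k = x ^ k / (1 - x ^ k), the generating functions of the total number
-- of parts are
--   odd parts:       ∏ 1 / (1 - x ^ (2 k - 1)) · ∑ g (2 k - 1),
--   distinct parts:  ∏ (1 + x ^ k) · ∑ (g k - 2 g (2 k)),
--   all partitions:  ∏ 1 / (1 - x ^ k) · ∑ g k.
-- By Euler's theorem the first two products agree, so the generating function
-- of b is ∏ 1 / (1 - x ^ (2 k - 1)) · ∑ g (2 k). By Gauss' identity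
--   ∑ x ^ (k (k + 1) / 2) = ∏ (1 - x ^ (2 k)) / (1 - x ^ (2 k - 1))
-- this is ∑ x ^ (k (k + 1) / 2) times the third function taken at x ^ 2.
-- To avoid infinite products, everything happens modulo a power of x.

module Submission where

open import Algebra.Bundles using (CommutativeRing)
import Algebra.Properties.AbelianGroup as AbelianGroupProperties
import Algebra.Properties.Ring as RingProperties
import Algebra.Properties.Semiring.Exp as Exponentiation
import Algebra.Properties.Semiring.Mult.TCOptimised as Multiples
import Algebra.Solver.Ring
open import Algebra.Solver.Ring.AlmostCommutativeRing using (fromCommutativeRing; _-Raw-AlmostCommutative⟶_)
open import Data.Integer.Base as ℤ using (ℤ; +_; 0ℤ; 1ℤ; -[1+_]; _⊖_)
import Data.Integer.Properties as ℤₚ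
import Data.Integer.Tactic.RingSolver as ℤ-Solver
open import Data.Maybe.Base as Maybe using (Maybe)
open import Data.Nat.Base as ℕ using (ℕ; zero; suc; _≤_; _<_; s≤s; z≤n)
import Data.Nat.Properties as ℕₚ
open import Data.Nat.Tactic.RingSolver using (solve-∀)
open import Relation.Binary.PropositionalEquality as ≡ using (_≡_)
import Relation.Binary.Reasoning.Setoid as SetoidReasoning
open import Relation.Nullary using (¬_; yes; no; contradiction)
open import Relation.Nullary.Decidable using (dec⇒maybe)

-- The analytic identities are proved in an arbitrary commutative ring with an element `x`
-- satisfying x ^ (2 L + 1) = 0. There 1 / (1 - x ^ k) is a finite geometric sum for k > 0, so every
-- generating function is a finite sum or product and every division is a multiplication by a known
-- inverse. Gauss' identity comes from Shanks' finite version, in which the sum of the first 2 L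
-- triangular powers equals the product of L factors times a sum whose terms beyond the leading one
-- contain x ^ (t (2 L + 1)) with t > 0. This is the origin of the exponent 2 L + 1: it kills these
-- terms and keeps all coefficients up to 2 L. The lists of partitions enter only through
-- recurrences in the bound on the parts, which determine the products and sums. Taking L = n + 1
-- keeps the coefficient of x ^ n and makes L positive also for n = 0.

-- A ring solver with integer coefficients over any commutative ring

module IntegerCoefficients {r ℓ} (R : CommutativeRing r ℓ) where
  open CommutativeRing R
  open AbelianGroupProperties +-abelianGroup using (⁻¹-∙-comm; ε⁻¹≈ε; ⁻¹-involutive)
  open RingProperties ring using (-‿distribˡ-*; -‿distribʳ-*)
  open Multiples semiring using (_×_; ×-homo-+; ×1-homo-*; 1+×)
  open SetoidReasoning setoid

  -- The optimised multiples make `⟦ + 1 ⟧` compute to `1#`, so that `con (+ 1)` in the solver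
  -- matches a literal `1#` in a goal.
  ⟦_⟧ : ℤ → Carrier
  ⟦ + n ⟧      = n × 1#
  ⟦ -[1+ n ] ⟧ = - (suc n × 1#)

  ⟦⟧-neg : ∀ i → ⟦ ℤ.- i ⟧ ≈ - ⟦ i ⟧
  ⟦⟧-neg (+ zero)   = sym ε⁻¹≈ε
  ⟦⟧-neg (+ suc n)  = refl
  ⟦⟧-neg (-[1+ n ]) = sym (⁻¹-involutive _)

  ⟦⟧-⊖ : ∀ m n → ⟦ m ⊖ n ⟧ ≈ m × 1# - n × 1#
  ⟦⟧-⊖ zero    zero    = sym (-‿inverseʳ 0#)
  ⟦⟧-⊖ zero    (suc n) = sym (+-identityˡ _)
  ⟦⟧-⊖ (suc m) zero    = sym (trans (+-congˡ ε⁻¹≈ε) (+-identityʳ _))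
  ⟦⟧-⊖ (suc m) (suc n) = begin
    ⟦ suc m ⊖ suc n ⟧                          ≡⟨ ≡.cong ⟦_⟧ (ℤₚ.[1+m]⊖[1+n]≡m⊖n m n) ⟩
    ⟦ m ⊖ n ⟧                                  ≈⟨ ⟦⟧-⊖ m n ⟩
    m × 1# - n × 1#                            ≈⟨ +-identityˡ _ ⟨
    0# + (m × 1# - n × 1#)                     ≈⟨ +-congʳ (-‿inverseʳ 1#) ⟨
    1# - 1# + (m × 1# - n × 1#)                ≈⟨ +-assoc _ _ _ ⟩
    1# + (- 1# + (m × 1# - n × 1#))            ≈⟨ +-congˡ (trans (sym (+-assoc _ _ _)) (trans (+-congʳ (+-comm _ _)) (+-assoc _ _ _))) ⟩
    1# + (m × 1# + (- 1# - n × 1#))            ≈⟨ +-assoc _ _ _ ⟨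
    (1# + m × 1#) + (- 1# - n × 1#)            ≈⟨ +-cong (sym (1+× m 1#)) (trans (⁻¹-∙-comm _ _) (-‿cong (sym (1+× n 1#)))) ⟩
    suc m × 1# - suc n × 1#                    ∎

  ⟦⟧-+ : ∀ i j → ⟦ i ℤ.+ j ⟧ ≈ ⟦ i ⟧ + ⟦ j ⟧
  ⟦⟧-+ (+ m)      (+ n)      = ×-homo-+ 1# m n
  ⟦⟧-+ (+ m)      (-[1+ n ]) = ⟦⟧-⊖ m (suc n)
  ⟦⟧-+ (-[1+ m ]) (+ n)      = trans (⟦⟧-⊖ n (suc m)) (+-comm _ _)
  ⟦⟧-+ (-[1+ m ]) (-[1+ n ]) = begin
    - (suc (suc (m ℕ.+ n)) × 1#)        ≡⟨ ≡.cong (λ k → - (suc k × 1#)) (ℕₚ.+-suc m n) ⟨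
    - ((suc m ℕ.+ suc n) × 1#)          ≈⟨ -‿cong (×-homo-+ 1# (suc m) (suc n)) ⟩
    - (suc m × 1# + suc n × 1#)         ≈⟨ ⁻¹-∙-comm _ _ ⟨
    - (suc m × 1#) - suc n × 1#         ∎

  ⟦⟧-*-+ : ∀ i n → ⟦ i ℤ.* + n ⟧ ≈ ⟦ i ⟧ * ⟦ + n ⟧
  ⟦⟧-*-+ (+ m)      n = trans (reflexive (≡.cong ⟦_⟧ (≡.sym (ℤₚ.pos-* m n)))) (×1-homo-* m n)
  ⟦⟧-*-+ (-[1+ m ]) n = begin
    ⟦ -[1+ m ] ℤ.* + n ⟧       ≡⟨ ≡.cong ⟦_⟧ (ℤₚ.neg-distribˡ-* (+ suc m) (+ n)) ⟨
    ⟦ ℤ.- (+ suc m ℤ.* + n) ⟧  ≈⟨ ⟦⟧-neg (+ suc m ℤ.* + n) ⟩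
    - ⟦ + suc m ℤ.* + n ⟧      ≈⟨ -‿cong (⟦⟧-*-+ (+ suc m) n) ⟩
    - (⟦ + suc m ⟧ * ⟦ + n ⟧)  ≈⟨ -‿distribˡ-* _ _ ⟩
    ⟦ -[1+ m ] ⟧ * ⟦ + n ⟧     ∎

  ⟦⟧-* : ∀ i j → ⟦ i ℤ.* j ⟧ ≈ ⟦ i ⟧ * ⟦ j ⟧
  ⟦⟧-* i (+ n)      = ⟦⟧-*-+ i n
  ⟦⟧-* i (-[1+ n ]) = begin
    ⟦ i ℤ.* -[1+ n ] ⟧       ≡⟨ ≡.cong ⟦_⟧ (ℤₚ.neg-distribʳ-* i (+ suc n)) ⟨
    ⟦ ℤ.- (i ℤ.* + suc n) ⟧  ≈⟨ ⟦⟧-neg (i ℤ.* + suc n) ⟩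
    - ⟦ i ℤ.* + suc n ⟧      ≈⟨ -‿cong (⟦⟧-*-+ i (suc n)) ⟩
    - (⟦ i ⟧ * ⟦ + suc n ⟧)  ≈⟨ -‿distribʳ-* _ _ ⟩
    ⟦ i ⟧ * ⟦ -[1+ n ] ⟧     ∎

  homomorphism : CommutativeRing.rawRing ℤₚ.+-*-commutativeRing -Raw-AlmostCommutative⟶ fromCommutativeRing R
  homomorphism = record
    { ⟦_⟧    = ⟦_⟧
    ; +-homo = ⟦⟧-+
    ; *-homo = ⟦⟧-*
    ; -‿homo = ⟦⟧-neg
    ; 0-homo = refl
    ; 1-homo = refl
    }

  ⟦⟧-≟ : ∀ i j → Maybe (⟦ i ⟧ ≈ ⟦ j ⟧)
  ⟦⟧-≟ i j = Maybe.map (λ { ≡.refl → refl }) (dec⇒maybe (i ℤₚ.≟ j))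

  open Algebra.Solver.Ring _ _ homomorphism ⟦⟧-≟ public
    using (solve; _:=_; _:+_; _:*_; _:-_; con)

-- Triangular numbers, finite sums and products

triangle : ℕ → ℕ
triangle zero    = 0
triangle (suc n) = suc n ℕ.+ triangle n

triangle-even : ∀ n → triangle (n ℕ.* 2) ≡ n ℕ.* suc (n ℕ.* 2)
triangle-even zero    = ≡.refl
triangle-even (suc n) = ≡.trans
  (≡.cong (λ t → suc (suc (n ℕ.* 2)) ℕ.+ (suc (n ℕ.* 2) ℕ.+ t)) (triangle-even n)) (arith n)
  where
  arith : ∀ n → suc (suc (n ℕ.* 2)) ℕ.+ (suc (n ℕ.* 2) ℕ.+ n ℕ.* suc (n ℕ.* 2)) ≡ suc n ℕ.* suc (suc n ℕ.* 2)
  arith = solve-∀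

module FiniteSums {r ℓ} (R : CommutativeRing r ℓ) where
  open CommutativeRing R
  open IntegerCoefficients R
  open SetoidReasoning setoid

  ∑ ∏ : (ℕ → Carrier) → ℕ → Carrier
  ∑ f zero    = 0#
  ∑ f (suc n) = ∑ f n + f n
  ∏ f zero    = 1#
  ∏ f (suc n) = ∏ f n * f n

  ∑-head : ∀ f n → (∀ k → f (suc k) ≈ 0#) → ∑ f (suc n) ≈ f 0
  ∑-head f zero    f≈0 = +-identityˡ _
  ∑-head f (suc n) f≈0 = trans (+-cong (∑-head f n f≈0) (f≈0 n)) (+-identityʳ _)

  ∑-truncate : ∀ f n → (∀ j → f (n ℕ.+ j) ≈ 0#) → ∀ j → ∑ f (n ℕ.+ j) ≈ ∑ f n
  ∑-truncate f n f≈0 zero    = reflexive (≡.cong (∑ f) (ℕₚ.+-identityʳ n))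
  ∑-truncate f n f≈0 (suc j) = begin
    ∑ f (n ℕ.+ suc j)             ≡⟨ ≡.cong (∑ f) (ℕₚ.+-suc n j) ⟩
    ∑ f (n ℕ.+ j) + f (n ℕ.+ j)   ≈⟨ +-cong (∑-truncate f n f≈0 j) (f≈0 j) ⟩
    ∑ f n + 0#                    ≈⟨ +-identityʳ _ ⟩
    ∑ f n                         ∎

  ∏-truncate : ∀ f n → (∀ j → f (n ℕ.+ j) ≈ 1#) → ∀ j → ∏ f (n ℕ.+ j) ≈ ∏ f n
  ∏-truncate f n f≈1 zero    = reflexive (≡.cong (∏ f) (ℕₚ.+-identityʳ n))
  ∏-truncate f n f≈1 (suc j) = begin
    ∏ f (n ℕ.+ suc j)             ≡⟨ ≡.cong (∏ f) (ℕₚ.+-suc n j) ⟩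
    ∏ f (n ℕ.+ j) * f (n ℕ.+ j)   ≈⟨ *-cong (∏-truncate f n f≈1 j) (f≈1 j) ⟩
    ∏ f n * 1#                    ≈⟨ *-identityʳ _ ⟩
    ∏ f n                         ∎

  ∏-* : ∀ f g n → ∏ f n * ∏ g n ≈ ∏ (λ k → f k * g k) n
  ∏-* f g zero    = *-identityʳ 1#
  ∏-* f g (suc n) = trans
    (solve 4 (λ a b c d → a :* b :* (c :* d) := a :* c :* (b :* d)) refl (∏ f n) (f n) (∏ g n) (g n))
    (*-congʳ (∏-* f g n))

  ∏-≈1 : ∀ {f} → (∀ k → f k ≈ 1#) → ∀ n → ∏ f n ≈ 1#
  ∏-≈1 f≈1 zero    = refl
  ∏-≈1 f≈1 (suc n) = trans (*-cong (∏-≈1 f≈1 n) (f≈1 n)) (*-identityʳ 1#)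

  ∏-inverse : ∀ {f g} → (∀ k → f k * g k ≈ 1#) → ∀ n → ∏ f n * ∏ g n ≈ 1#
  ∏-inverse {f} {g} fg≈1 n = trans (∏-* f g n) (∏-≈1 fg≈1 n)

  ∏-cong : ∀ {f g} → (∀ k → f k ≈ g k) → ∀ n → ∏ f n ≈ ∏ g n
  ∏-cong f≈g zero    = refl
  ∏-cong f≈g (suc n) = *-cong (∏-cong f≈g n) (f≈g n)

  ∑-even-odd : ∀ f n → ∑ f (n ℕ.* 2) ≈ ∑ (λ k → f (k ℕ.* 2)) n + ∑ (λ k → f (suc (k ℕ.* 2))) n
  ∑-even-odd f zero    = sym (+-identityʳ 0#)
  ∑-even-odd f (suc n) = trans (+-congʳ (+-congʳ (∑-even-odd f n)))
    (solve 4 (λ a b c d → a :+ b :+ c :+ d := a :+ c :+ (b :+ d)) refl _ _ _ _)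

  ∏-even-odd : ∀ f n → ∏ f (n ℕ.* 2) ≈ ∏ (λ k → f (k ℕ.* 2)) n * ∏ (λ k → f (suc (k ℕ.* 2))) n
  ∏-even-odd f zero    = sym (*-identityʳ 1#)
  ∏-even-odd f (suc n) = trans (*-congʳ (*-congʳ (∏-even-odd f n)))
    (solve 4 (λ a b c d → a :* b :* c :* d := a :* c :* (b :* d)) refl _ _ _ _)

-- Geometric series in a nilpotent element

PowerVanishes : ∀ {r ℓ} (R : CommutativeRing r ℓ) → CommutativeRing.Carrier R → ℕ → Set ℓ
PowerVanishes R x n = x ^ n ≈ 0#
  where
  open CommutativeRing R
  open Exponentiation semiring

module NilpotentIdentities {r ℓ} (R : CommutativeRing r ℓ) (x : CommutativeRing.Carrier R)
                           (l : ℕ) (x-nilpotent : PowerVanishes R x (suc (suc l ℕ.* 2))) where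

  open CommutativeRing R
  open Exponentiation semiring
  open IntegerCoefficients R
  open FiniteSums R
  open SetoidReasoning setoid

  private
    L = suc l

  ^-vanish : ∀ {k} → L ℕ.* 2 < k → x ^ k ≈ 0#
  ^-vanish {k} 2L<k = begin
    x ^ k                                                 ≡⟨ ≡.cong (x ^_) (ℕₚ.m+[n∸m]≡n 2L<k) ⟨
    x ^ (suc (L ℕ.* 2) ℕ.+ (k ℕ.∸ suc (L ℕ.* 2)))         ≈⟨ ^-homo-* x (suc (L ℕ.* 2)) _ ⟩
    x ^ suc (L ℕ.* 2) * x ^ (k ℕ.∸ suc (L ℕ.* 2))         ≈⟨ *-congʳ x-nilpotent ⟩
    0# * x ^ (k ℕ.∸ suc (L ℕ.* 2))                        ≈⟨ zeroˡ _ ⟩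
    0#                                                    ∎

  geometric : ∀ y n → (1# - y) * ∑ (y ^_) n ≈ 1# - y ^ n
  geometric y zero    = solve 1 (λ y → (con (+ 1) :- y) :* con (+ 0) := con (+ 1) :- con (+ 1)) refl y
  geometric y (suc n) = begin
    (1# - y) * (∑ (y ^_) n + y ^ n)             ≈⟨ distribˡ _ _ _ ⟩
    (1# - y) * ∑ (y ^_) n + (1# - y) * y ^ n    ≈⟨ +-congʳ (geometric y n) ⟩
    (1# - y ^ n) + (1# - y) * y ^ n             ≈⟨ solve 2 (λ y p → (con (+ 1) :- p) :+ (con (+ 1) :- y) :* p := con (+ 1) :- y :* p) refl y (y ^ n) ⟩
    1# - y * y ^ n                              ∎

  -- The reciprocal of 1 - x ^ k, for k > 0.
  ι : ℕ → Carrier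
  ι k = ∑ ((x ^ k) ^_) (suc (L ℕ.* 2))

  ι-inverse : ∀ k → (1# - x ^ suc k) * ι (suc k) ≈ 1#
  ι-inverse k = begin
    (1# - x ^ suc k) * ι (suc k)           ≈⟨ geometric (x ^ suc k) (suc (L ℕ.* 2)) ⟩
    1# - (x ^ suc k) ^ suc (L ℕ.* 2)       ≈⟨ +-congˡ (-‿cong (trans (^-assocʳ x (suc k) (suc (L ℕ.* 2))) (^-vanish (ℕₚ.m≤m+n _ _)))) ⟩
    1# - 0#                                ≈⟨ solve 0 (con (+ 1) :- con (+ 0) := con (+ 1)) refl ⟩
    1#                                     ∎

  g : ℕ → Carrier
  g k = x ^ k * ι k

  g-vanish : ∀ {k} → L ℕ.* 2 < k → g k ≈ 0#
  g-vanish 2L<k = trans (*-congʳ (^-vanish 2L<k)) (zeroˡ _)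

  ^-double : ∀ k → x ^ (k ℕ.* 2) ≈ x ^ k * x ^ k
  ^-double zero    = sym (*-identityʳ 1#)
  ^-double (suc k) = trans (*-congˡ (*-congˡ (^-double k)))
    (solve 2 (λ x y → x :* (x :* (y :* y)) := x :* y :* (x :* y)) refl x (x ^ k))

  -- Shanks' proof of Gauss' identity for triangular numbers

  -- `P n` consists of the first n factors (1 - x ^ (2 k)) / (1 - x ^ (2 k - 1)) of Gauss' product,
  -- and `J n` is its reciprocal. The index of `e` starts at the vanishing `e 0`, which serves as
  -- the lower end of the telescoping sum.
  e o ratio ratio⁻¹ J P : ℕ → Carrier
  e k       = 1# - x ^ (k ℕ.* 2)
  o k       = 1# - x ^ suc (k ℕ.* 2)
  ratio k   = e (suc k) * ι (suc (k ℕ.* 2))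
  ratio⁻¹ k = o k * ι (suc k ℕ.* 2)
  P         = ∏ ratio
  J         = ∏ ratio⁻¹

  PJ≈1 : ∀ n → P n * J n ≈ 1#
  PJ≈1 = ∏-inverse λ k → begin
    ratio k * ratio⁻¹ k
      ≈⟨ solve 4 (λ a b c d → a :* b :* (c :* d) := a :* d :* (c :* b)) refl (e (suc k)) _ (o k) _ ⟩
    e (suc k) * ι (suc k ℕ.* 2) * (o k * ι (suc (k ℕ.* 2)))
      ≈⟨ *-cong (ι-inverse (suc (k ℕ.* 2))) (ι-inverse (k ℕ.* 2)) ⟩
    1# * 1#
      ≈⟨ *-identityʳ 1# ⟩
    1# ∎

  -- With the denominator cleared, this is the shape in which the boundary term of `B-suc` passes
  -- from `s` to `suc s`.
  J-suc : ∀ s → J (suc s) * e (suc s) ≈ J s * o s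
  J-suc s = begin
    J s * (o s * ι (suc s ℕ.* 2)) * e (suc s)    ≈⟨ solve 4 (λ j o i e → j :* (o :* i) :* e := j :* o :* (e :* i)) refl (J s) (o s) _ (e (suc s)) ⟩
    J s * o s * (e (suc s) * ι (suc s ℕ.* 2))    ≈⟨ *-congˡ (ι-inverse (suc (s ℕ.* 2))) ⟩
    J s * o s * 1#                               ≈⟨ *-identityʳ _ ⟩
    J s * o s                                    ∎

  -- B n n is Shanks' sum of (P n / P t) x ^ (t (2 n + 1)) over t < n.
  B : ℕ → ℕ → Carrier
  B n s = P n * ∑ (λ t → J t * x ^ (t ℕ.* suc (n ℕ.* 2))) s

  ^-shift : ∀ n t → x ^ (t ℕ.* suc (suc n ℕ.* 2)) ≈ x ^ (t ℕ.* suc (n ℕ.* 2)) * x ^ (t ℕ.* 2)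
  ^-shift n t = trans (reflexive (≡.cong (x ^_) (arith n t))) (^-homo-* x (t ℕ.* suc (n ℕ.* 2)) _)
    where
    arith : ∀ n t → t ℕ.* suc (suc n ℕ.* 2) ≡ t ℕ.* suc (n ℕ.* 2) ℕ.+ t ℕ.* 2
    arith = solve-∀

  -- The difference B (suc n) - B n telescopes in s; the lower end vanishes
  -- because e 0 = 0.
  B-suc : ∀ n s → B (suc n) s ≈
    B n s + P n * ι (suc (n ℕ.* 2)) * (J s * e s * x ^ (s ℕ.* suc (n ℕ.* 2)))
  B-suc n zero    = solve 3 (λ p p′ i → p′ :* con (+ 0)
    := p :* con (+ 0) :+ p :* i :* (con (+ 1) :* (con (+ 1) :- con (+ 1)) :* con (+ 1)))
    refl (P n) (P (suc n)) (ι (suc (n ℕ.* 2)))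
  B-suc n (suc s) = begin
    P′ * (Σ′ + j * x ^ (s ℕ.* suc (suc n ℕ.* 2)))
      ≈⟨ trans (distribˡ _ _ _) (+-cong (B-suc n s) (*-congˡ (*-congˡ (^-shift n s)))) ⟩
    p * Σ₀ + p * i * (j * (1# - b) * a) + p * ((1# - x * c) * i) * (j * (a * b))
      -- The identity behind this is (1 - b) + (1 - x c) b = 1 - x b c = (1 - c) + c (1 - x b). The
      -- part with 1 - c cancels `i` and becomes the next summand of `B n`; the part with 1 - x b,
      -- which is `o s`, becomes the next boundary term.
      ≈⟨ solve 8 (λ p s i j a b c x →
           p :* s :+ p :* i :* (j :* (con (+ 1) :- b) :* a) :+ p :* ((con (+ 1) :- x :* c) :* i) :* (j :* (a :* b))
           := p :* (s :+ (con (+ 1) :- c) :* i :* (j :* a)) :+ p :* i :* (j :* (con (+ 1) :- x :* b) :* (c :* a)))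
         refl p Σ₀ i j a b c x ⟩
    p * (Σ₀ + (1# - c) * i * (j * a)) + p * i * (j * o s * (c * a))
      ≈⟨ +-cong (*-congˡ (+-congˡ (trans (*-congʳ (ι-inverse (n ℕ.* 2))) (*-identityˡ _))))
                (*-congˡ (*-cong (sym (J-suc s)) (sym (^-homo-* x (suc (n ℕ.* 2)) _)))) ⟩
    p * (Σ₀ + j * a) + p * i * (J (suc s) * e (suc s) * x ^ (suc s ℕ.* suc (n ℕ.* 2))) ∎
    where
    P′ = P (suc n)
    Σ′ = ∑ (λ t → J t * x ^ (t ℕ.* suc (suc n ℕ.* 2))) s
    Σ₀ = ∑ (λ t → J t * x ^ (t ℕ.* suc (n ℕ.* 2))) s
    p = P n
    i = ι (suc (n ℕ.* 2))
    j = J s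
    a = x ^ (s ℕ.* suc (n ℕ.* 2))
    b = x ^ (s ℕ.* 2)
    c = x ^ suc (n ℕ.* 2)

  -- Passing from n to n + 1, the boundary term of `B-suc` at s = n and the new summand t = n
  -- together contribute x ^ (n (2 n + 1)) + x ^ ((n + 1) (2 n + 1)). These exponents are the
  -- triangular numbers with indices 2 n and 2 n + 1.
  shanks : ∀ n → B n n ≈ ∑ (λ s → x ^ triangle s) (n ℕ.* 2)
  shanks zero    = zeroʳ _
  shanks (suc n) = begin
    P (suc n) * (Σ′ + j * x ^ (n ℕ.* suc (suc n ℕ.* 2)))
      ≈⟨ trans (distribˡ _ _ _) (+-cong (B-suc n n) (*-congˡ (*-congˡ (^-shift n n)))) ⟩
    B n n + p * i * (j * (1# - b) * a) + p * ((1# - x * (x * b)) * i) * (j * (a * b))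
      -- Here (1 - b) + (1 - x x b) b = 1 - (x b) (x b) splits as (1 - x b) (1 + x b); the first
      -- factor cancels `i`, and `p * j` is 1.
      ≈⟨ solve 7 (λ q p i j a b x →
            q :+ p :* i :* (j :* (con (+ 1) :- b) :* a) :+ p :* ((con (+ 1) :- x :* (x :* b)) :* i) :* (j :* (a :* b))
            := q :+ p :* j :* ((con (+ 1) :- x :* b) :* i) :* (a :+ x :* b :* a))
          refl (B n n) p i j a b x ⟩
    B n n + p * j * ((1# - x * b) * i) * (a + x * b * a)
      ≈⟨ +-cong (shanks n) (*-congʳ (trans (*-cong (PJ≈1 n) (ι-inverse (n ℕ.* 2))) (*-identityʳ 1#))) ⟩
    T + 1# * (a + x * b * a)
      ≈⟨ solve 3 (λ t a c → t :+ con (+ 1) :* (a :+ c :* a) := t :+ a :+ c :* a) refl T a (x * b) ⟩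
    T + a + x * b * a
      ≈⟨ +-cong (+-congˡ a≈) (trans (*-congˡ a≈) (sym (^-homo-* x (suc (n ℕ.* 2)) _))) ⟩
    ∑ (λ s → x ^ triangle s) (suc n ℕ.* 2) ∎
    where
    Σ′ = ∑ (λ t → J t * x ^ (t ℕ.* suc (suc n ℕ.* 2))) n
    T = ∑ (λ s → x ^ triangle s) (n ℕ.* 2)
    p = P n
    i = ι (suc (n ℕ.* 2))
    j = J n
    a = x ^ (n ℕ.* suc (n ℕ.* 2))
    b = x ^ (n ℕ.* 2)
    a≈ : a ≈ x ^ triangle (n ℕ.* 2)
    a≈ = reflexive (≡.cong (x ^_) (≡.sym (triangle-even n)))

  -- Modulo x ^ (2 L + 1), only the summand s = 0 of B L L survives.
  gauss : ∑ (λ s → x ^ triangle s) (L ℕ.* 2) ≈ P L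
  gauss = begin
    ∑ (λ s → x ^ triangle s) (L ℕ.* 2)  ≈⟨ shanks L ⟨
    B L L                               ≈⟨ *-congˡ (∑-head _ l λ k → trans (*-congˡ (^-vanish (ℕₚ.m≤m+n _ _))) (zeroʳ _)) ⟩
    P L * (1# * 1#)                     ≈⟨ solve 1 (λ p → p :* (con (+ 1) :* con (+ 1)) := p) refl (P L) ⟩
    P L                                 ∎

  -- Euler's theorem and the products for odd and even parts

  oddProduct evenProduct : ℕ → Carrier
  oddProduct  = ∏ λ k → ι (suc (k ℕ.* 2))
  evenProduct = ∏ λ k → ι (suc k ℕ.* 2)

  odd-inverse : ∀ n → ∏ o n * oddProduct n ≈ 1#
  odd-inverse = ∏-inverse λ k → ι-inverse (k ℕ.* 2)

  even-inverse : ∀ n → ∏ (λ k → e (suc k)) n * evenProduct n ≈ 1#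
  even-inverse = ∏-inverse λ k → ι-inverse (suc (k ℕ.* 2))

  distinctProduct : ℕ → Carrier
  distinctProduct = ∏ λ k → 1# + x ^ suc k

  -- Dividing Gauss' identity by its numerator gives the form that exchanges the product for odd
  -- parts with the one for even parts.
  gauss′ : ∑ (λ s → x ^ triangle s) (L ℕ.* 2) * evenProduct L ≈ oddProduct L
  gauss′ = begin
    ∑ (λ s → x ^ triangle s) (L ℕ.* 2) * evenProduct L  ≈⟨ *-congʳ (trans gauss (sym (∏-* (λ k → e (suc k)) _ L))) ⟩
    F * oddProduct L * evenProduct L                    ≈⟨ solve 3 (λ f o e → f :* o :* e := f :* e :* o) refl F (oddProduct L) (evenProduct L) ⟩
    F * evenProduct L * oddProduct L                    ≈⟨ *-congʳ (even-inverse L) ⟩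
    1# * oddProduct L                                   ≈⟨ *-identityˡ _ ⟩
    oddProduct L                                        ∎
    where
    F = ∏ (λ k → e (suc k)) L

  -- Multiplying by all 1 - x ^ k with k ≤ 2 L, which are L odd and L even factors, turns the left
  -- side into the product of 1 - x ^ (2 k) over k ≤ 2 L. Its factors with k > L are 1 by
  -- nilpotency, so the even factors cancel and the reciprocal of the odd ones remains.
  euler : distinctProduct (L ℕ.* 2) ≈ oddProduct L
  euler = begin
    D                            ≈⟨ *-identityʳ D ⟨
    D * 1#                       ≈⟨ *-congˡ (trans (*-cong (odd-inverse L) (even-inverse L)) (*-identityʳ 1#)) ⟨
    D * (O * I * (F * K))        ≈⟨ solve 5 (λ d o i f k → d :* (o :* i :* (f :* k)) := d :* (o :* f) :* (i :* k)) refl D O I F K ⟩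
    D * (O * F) * (I * K)        ≈⟨ *-congʳ (*-congˡ (∏-even-odd (λ k → 1# - x ^ suc k) L)) ⟨
    D * E * (I * K)              ≈⟨ *-congʳ (trans (∏-* _ _ (L ℕ.* 2)) (∏-cong difference-of-squares (L ℕ.* 2))) ⟩
    ∏ (λ k → e (suc k)) (L ℕ.* 2) * (I * K)   ≡⟨ ≡.cong (λ m → ∏ (λ k → e (suc k)) m * (I * K)) L*2≡L+L ⟩
    ∏ (λ k → e (suc k)) (L ℕ.+ L) * (I * K)   ≈⟨ *-congʳ (∏-truncate _ L e≈1 L) ⟩
    F * (I * K)                  ≈⟨ solve 3 (λ f i k → f :* (i :* k) := i :* (f :* k)) refl F I K ⟩
    I * (F * K)                  ≈⟨ trans (*-congˡ (even-inverse L)) (*-identityʳ I) ⟩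
    I                            ∎
    where
    D = distinctProduct (L ℕ.* 2)
    E = ∏ (λ k → 1# - x ^ suc k) (L ℕ.* 2)
    O = ∏ o L
    I = oddProduct L
    F = ∏ (λ k → e (suc k)) L
    K = evenProduct L
    L*2≡L+L : L ℕ.* 2 ≡ L ℕ.+ L
    L*2≡L+L = ≡.trans (ℕₚ.*-comm L 2) (≡.cong (L ℕ.+_) (ℕₚ.+-identityʳ L))
    difference-of-squares : ∀ k → (1# + x ^ suc k) * (1# - x ^ suc k) ≈ e (suc k)
    difference-of-squares k = trans
      (solve 1 (λ y → (con (+ 1) :+ y) :* (con (+ 1) :- y) := con (+ 1) :- y :* y) refl (x ^ suc k))
      (+-congˡ (-‿cong (sym (^-double (suc k)))))
    e≈1 : ∀ j → e (suc (L ℕ.+ j)) ≈ 1#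
    e≈1 j = trans (+-congˡ (-‿cong (^-vanish (ℕₚ.*-monoˡ-< 2 (s≤s (ℕₚ.m≤m+n L j))))))
                  (solve 0 (con (+ 1) :- con (+ 0) := con (+ 1)) refl)

  -- Products and sums determined by recurrences

  -- The recurrences satisfied by the generating functions of the number of
  -- partitions and of the total number of parts, when the j-th part k j is
  -- allowed with any multiplicity, respectively at most once.
  record Repeated (k : ℕ → ℕ) (count total : ℕ → Carrier) : Set ℓ where
    field
      count-zero : count 0 ≈ 1#
      count-suc  : ∀ j → count (suc j) ≈ count j + x ^ k j * count (suc j)
      total-zero : total 0 ≈ 0#
      total-suc  : ∀ j → total (suc j) ≈ total j + x ^ k j * (count (suc j) + total (suc j))

  record Distinct (k : ℕ → ℕ) (count total : ℕ → Carrier) : Set ℓ where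
    field
      count-zero : count 0 ≈ 1#
      count-suc  : ∀ j → count (suc j) ≈ count j + x ^ k j * count j
      total-zero : total 0 ≈ 0#
      total-suc  : ∀ j → total (suc j) ≈ total j + x ^ k j * (count j + total j)

  geometric-solve : ∀ k {y z} → y ≈ z + x ^ suc k * y → y ≈ z * ι (suc k)
  geometric-solve k {y} {z} y≈ = begin
    y                                    ≈⟨ trans (*-congˡ (ι-inverse k)) (*-identityʳ y) ⟨
    y * ((1# - w) * i)                   ≈⟨ solve 3 (λ y w i → y :* ((con (+ 1) :- w) :* i) := (y :- w :* y) :* i) refl y w i ⟩
    (y - w * y) * i                      ≈⟨ *-congʳ (+-congʳ y≈) ⟩
    (z + w * y - w * y) * i              ≈⟨ solve 4 (λ z w y i → (z :+ w :* y :- w :* y) :* i := z :* i) refl z w y i ⟩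
    z * i                                ∎
    where
    w = x ^ suc k
    i = ι (suc k)

  repeated-count : ∀ (k : ℕ → ℕ) {count total} → Repeated (λ j → suc (k j)) count total →
                   ∀ m → count m ≈ ∏ (λ j → ι (suc (k j))) m
  repeated-count k rec zero    = Repeated.count-zero rec
  repeated-count k rec (suc m) = trans (geometric-solve (k m) (Repeated.count-suc rec m)) (*-congʳ (repeated-count k rec m))

  -- Marking every part by a variable z gives ∏ 1 / (1 - z x ^ k). Its derivative at z = 1 counts
  -- the parts, and its logarithmic derivative there is the sum of the `g k`; the induction on `m`
  -- is the product rule.
  repeated-total : ∀ (k : ℕ → ℕ) {count total} → Repeated (λ j → suc (k j)) count total →
                   ∀ m → total m ≈ count m * ∑ (λ j → g (suc (k j))) m
  repeated-total k rec zero    = trans (Repeated.total-zero rec) (sym (zeroʳ _))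
  repeated-total k {count} {total} rec (suc m) = begin
    total (suc m)                        ≈⟨ geometric-solve (k m) (trans (total-suc m) regroup) ⟩
    (total m + w * count (suc m)) * i    ≈⟨ *-congʳ (+-congʳ (repeated-total k rec m)) ⟩
    (count m * G + w * count (suc m)) * i
      ≈⟨ solve 5 (λ a b G w i → (a :* G :+ w :* b) :* i := a :* i :* G :+ b :* (w :* i)) refl (count m) (count (suc m)) G w i ⟩
    count m * i * G + count (suc m) * (w * i)
      ≈⟨ +-congʳ (*-congʳ (geometric-solve (k m) (count-suc m))) ⟨
    count (suc m) * G + count (suc m) * (w * i)
      ≈⟨ distribˡ _ _ _ ⟨
    count (suc m) * (G + w * i) ∎
    where
    open Repeated rec
    w = x ^ suc (k m)
    i = ι (suc (k m))
    G = ∑ (λ j → g (suc (k j))) m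
    regroup : total m + w * (count (suc m) + total (suc m)) ≈ total m + w * count (suc m) + w * total (suc m)
    regroup = trans (+-congˡ (distribˡ _ _ _)) (sym (+-assoc _ _ _))

  distinct-count : ∀ (k : ℕ → ℕ) {count total} → Distinct k count total → ∀ m → count m ≈ ∏ (λ j → 1# + x ^ k j) m
  distinct-count k rec zero = Distinct.count-zero rec
  distinct-count k {count} rec (suc m) = begin
    count (suc m)                ≈⟨ Distinct.count-suc rec m ⟩
    count m + x ^ k m * count m  ≈⟨ solve 2 (λ a w → a :+ w :* a := a :* (con (+ 1) :+ w)) refl (count m) (x ^ k m) ⟩
    count m * (1# + x ^ k m)     ≈⟨ *-congʳ (distinct-count k rec m) ⟩
    ∏ (λ j → 1# + x ^ k j) (suc m) ∎

  -- x ^ k / (1 + x ^ k) = g k - 2 g (2 k).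
  h : ℕ → Carrier
  h k = g k - (g (k ℕ.* 2) + g (k ℕ.* 2))

  -- This characterises `h` as x ^ k / (1 + x ^ k) without a separate reciprocal of 1 + x ^ k.
  h-equation : ∀ k → (1# + x ^ suc k) * h (suc k) ≈ x ^ suc k
  h-equation k = begin
    (1# + y) * (y * i - (x ^ (suc k ℕ.* 2) * i₂ + x ^ (suc k ℕ.* 2) * i₂))
      ≈⟨ *-congˡ (+-congˡ (-‿cong (+-cong (*-congʳ (^-double (suc k))) (*-congʳ (^-double (suc k)))))) ⟩
    (1# + y) * (y * i - (y * y * i₂ + y * y * i₂))
      -- The inserted factor (1 - y y) `i₂` = 1 serves to rewrite 1 / (1 - y) as (1 + y) / (1 - y
      -- y), a common denominator with the subtracted terms.
      ≈⟨ *-congˡ (+-congʳ (*-congˡ (trans (*-congˡ inverse₂) (*-identityʳ i)))) ⟨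
    (1# + y) * (y * (i * ((1# - y * y) * i₂)) - (y * y * i₂ + y * y * i₂))
      ≈⟨ solve 3 (λ y i i₂ →
           (con (+ 1) :+ y) :* (y :* (i :* ((con (+ 1) :- y :* y) :* i₂)) :- (y :* y :* i₂ :+ y :* y :* i₂))
           := (con (+ 1) :+ y) :* (y :* ((con (+ 1) :- y) :* i :* ((con (+ 1) :+ y) :* i₂)) :- (y :* y :* i₂ :+ y :* y :* i₂)))
         refl y i i₂ ⟩
    (1# + y) * (y * ((1# - y) * i * ((1# + y) * i₂)) - (y * y * i₂ + y * y * i₂))
      ≈⟨ *-congˡ (+-congʳ (*-congˡ (trans (*-congʳ (ι-inverse k)) (*-identityˡ _)))) ⟩
    (1# + y) * (y * ((1# + y) * i₂) - (y * y * i₂ + y * y * i₂))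
      ≈⟨ solve 2 (λ y i₂ → (con (+ 1) :+ y) :* (y :* ((con (+ 1) :+ y) :* i₂) :- (y :* y :* i₂ :+ y :* y :* i₂))
           := y :* ((con (+ 1) :- y :* y) :* i₂)) refl y i₂ ⟩
    y * ((1# - y * y) * i₂)
      ≈⟨ trans (*-congˡ inverse₂) (*-identityʳ y) ⟩
    y ∎
    where
    y = x ^ suc k
    i = ι (suc k)
    i₂ = ι (suc k ℕ.* 2)
    inverse₂ : (1# - y * y) * i₂ ≈ 1#
    inverse₂ = trans (*-congʳ (+-congˡ (-‿cong (sym (^-double (suc k)))))) (ι-inverse (suc (k ℕ.* 2)))

  -- The logarithmic derivative of ∏ (1 + z x ^ k) at z = 1 is the sum of the `h k`.
  distinct-total : ∀ (k : ℕ → ℕ) {count total} → Distinct (λ j → suc (k j)) count total →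
                   ∀ m → total m ≈ count m * ∑ (λ j → h (suc (k j))) m
  distinct-total k rec zero = trans (Distinct.total-zero rec) (sym (zeroʳ _))
  distinct-total k {count} {total} rec (suc m) = begin
    total (suc m)
      ≈⟨ total-suc m ⟩
    total m + w * (count m + total m)
      ≈⟨ +-cong (distinct-total k rec m) (*-congˡ (+-congˡ (distinct-total k rec m))) ⟩
    count m * H + w * (count m + count m * H)
      ≈⟨ solve 3 (λ a H w → a :* H :+ w :* (a :+ a :* H) := (a :+ w :* a) :* H :+ a :* w) refl (count m) H w ⟩
    (count m + w * count m) * H + count m * w
      ≈⟨ +-congˡ (*-congˡ (h-equation (k m))) ⟨
    (count m + w * count m) * H + count m * ((1# + w) * h (suc (k m)))
      ≈⟨ solve 4 (λ a H w h → (a :+ w :* a) :* H :+ a :* ((con (+ 1) :+ w) :* h) := (a :+ w :* a) :* (H :+ h))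
           refl (count m) H w (h (suc (k m))) ⟩
    (count m + w * count m) * (H + h (suc (k m)))
      ≈⟨ *-congʳ (count-suc m) ⟨
    count (suc m) * (H + h (suc (k m))) ∎
    where
    open Distinct rec
    w = x ^ suc (k m)
    H = ∑ (λ j → h (suc (k j))) m

  ∑-+ : ∀ f f′ n → ∑ (λ k → f k - (f′ k + f′ k)) n ≈ ∑ f n - (∑ f′ n + ∑ f′ n)
  ∑-+ f f′ zero    = solve 0 (con (+ 0) := con (+ 0) :- (con (+ 0) :+ con (+ 0))) refl
  ∑-+ f f′ (suc n) = trans (+-congʳ (∑-+ f f′ n))
    (solve 4 (λ a b c d → a :- (b :+ b) :+ (c :- (d :+ d)) := a :+ c :- ((b :+ d) :+ (b :+ d))) refl _ _ _ _)

  -- Each even index occurs once in the sum of the `g k` and is subtracted twice; the subtracted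
  -- terms with index above 2 L vanish.
  ∑h : ∑ (λ k → h (suc k)) (L ℕ.* 2) ≈ ∑ (λ k → g (suc (k ℕ.* 2))) L - ∑ (λ k → g (suc k ℕ.* 2)) L
  ∑h = begin
    ∑ (λ k → h (suc k)) (L ℕ.* 2)           ≈⟨ ∑-+ (λ k → g (suc k)) (λ k → g (suc k ℕ.* 2)) (L ℕ.* 2) ⟩
    ∑ (λ k → g (suc k)) (L ℕ.* 2) - (G₂ (L ℕ.* 2) + G₂ (L ℕ.* 2))
      ≈⟨ +-cong (∑-even-odd (λ k → g (suc k)) L) (-‿cong (+-cong truncate truncate)) ⟩
    G₁ + G₂ L - (G₂ L + G₂ L)               ≈⟨ solve 2 (λ a b → a :+ b :- (b :+ b) := a :- b) refl G₁ (G₂ L) ⟩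
    G₁ - G₂ L                               ∎
    where
    G₁ = ∑ (λ k → g (suc (k ℕ.* 2))) L
    G₂ = ∑ (λ k → g (suc k ℕ.* 2))
    truncate : G₂ (L ℕ.* 2) ≈ G₂ L
    truncate = trans
      (reflexive (≡.cong G₂ (≡.trans (ℕₚ.*-comm L 2) (≡.cong (L ℕ.+_) (ℕₚ.+-identityʳ L)))))
      (∑-truncate (λ k → g (suc k ℕ.* 2)) L (λ j → g-vanish (ℕₚ.*-monoˡ-< 2 (s≤s (ℕₚ.m≤m+n L j)))) L)

  total-difference :
    ∀ {oddCount oddTotal distinctCount distinctTotal evenCount evenTotal} →
    Repeated (λ j → suc (j ℕ.* 2)) oddCount oddTotal →
    Distinct suc distinctCount distinctTotal →
    Repeated (λ j → suc j ℕ.* 2) evenCount evenTotal →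
    oddTotal L - distinctTotal (L ℕ.* 2) ≈ ∑ (λ s → x ^ triangle s) (L ℕ.* 2) * evenTotal L
  total-difference {oddCount} {oddTotal} {distinctCount} {distinctTotal} {evenCount} {evenTotal} odd distinct even = begin
    oddTotal L - distinctTotal (L ℕ.* 2)
      ≈⟨ +-cong (trans (repeated-total (ℕ._* 2) odd L) (*-congʳ (repeated-count (ℕ._* 2) odd L)))
                (-‿cong (trans (distinct-total (λ j → j) distinct (L ℕ.* 2))
                               (*-cong (trans (distinct-count suc distinct (L ℕ.* 2)) euler) ∑h))) ⟩
    I * G₁ - I * (G₁ - G₂)
      ≈⟨ solve 3 (λ i a b → i :* a :- i :* (a :- b) := i :* b) refl I G₁ G₂ ⟩
    I * G₂
      ≈⟨ *-congʳ gauss′ ⟨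
    T * evenProduct L * G₂
      ≈⟨ *-assoc _ _ _ ⟩
    T * (evenProduct L * G₂)
      ≈⟨ *-congˡ (trans (repeated-total (λ j → suc (j ℕ.* 2)) even L) (*-congʳ (repeated-count (λ j → suc (j ℕ.* 2)) even L))) ⟨
    T * evenTotal L ∎
    where
    T = ∑ (λ s → x ^ triangle s) (L ℕ.* 2)
    I = oddProduct L
    G₁ = ∑ (λ k → g (suc (k ℕ.* 2))) L
    G₂ = ∑ (λ k → g (suc k ℕ.* 2)) L

-- Truncated power series

open import Defs
open import Data.List.Base using (List; []; _∷_; _++_; map; concatMap; filter; length; replicate; upTo)
open import Data.List.Properties hiding (sum-++)
open import Data.List.Relation.Unary.All as All using (All; []; _∷_; all?)
import Data.List.Relation.Unary.All.Properties as Allₚ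
open import Data.List.Relation.Unary.AllPairs using ([]; _∷_)
open import Data.List.Relation.Unary.Unique.DecPropositional ℕₚ._≟_ using (unique?)
open import Data.List.Relation.Unary.Unique.Propositional using (Unique)
open import Data.Nat.Base using (_∸_)
open import Data.Nat.Coprimality using (1-coprimeTo) renaming (sym to coprime-sym)
open import Data.Nat.Divisibility using (_∣_; divides; ∣m+n∣m⇒∣n; ∣1⇒≡1)
open import Data.Nat.ListAction using (sum)
open import Data.Nat.ListAction.Properties using (sum-++)
open import Data.Product.Base using (_×_; _,_; proj₂)
open import Data.Rational.Base as ℚ using (ℚ; mkℚ; toℚᵘ)
import Data.Rational.Properties as ℚₚ
open import Data.Rational.Unnormalised.Base as ℚᵘ using (mkℚᵘ; *≡*; _≃_)
import Data.Rational.Unnormalised.Properties as ℚᵘₚ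
open import Function.Base using (_∘_)
open import Level using (0ℓ)
open import Relation.Unary using (Pred; Decidable)
open ≡
open ℕₚ

Series : Set
Series = ℕ → ℤ

infixl 6 _⊕_
infixl 7 _⊛_

zeroˢ oneˢ X : Series
zeroˢ _      = 0ℤ
oneˢ zero    = 1ℤ
oneˢ (suc _) = 0ℤ
X zero       = 0ℤ
X (suc n)    = oneˢ n

-- The Cauchy product is computed from f = f 0 + x (f ∘ suc), which allows structural induction on
-- the index of the coefficient in place of manipulations of double sums.
_⊕_ _⊛_ : Series → Series → Series
(f ⊕ g) n       = f n ℤ.+ g n
(f ⊛ g) zero    = f 0 ℤ.* g 0
(f ⊛ g) (suc n) = f 0 ℤ.* g (suc n) ℤ.+ (f ∘ suc ⊛ g) n

negate : Series → Series
negate f n = ℤ.- f n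

-- The bounds on `i` are what makes equality up to a fixed degree compatible with multiplication.
⊛-cong : ∀ {f f′ g g′} n → (∀ i → i ≤ n → f i ≡ f′ i) → (∀ i → i ≤ n → g i ≡ g′ i) → (f ⊛ g) n ≡ (f′ ⊛ g′) n
⊛-cong zero    f≡ g≡ = cong₂ ℤ._*_ (f≡ 0 z≤n) (g≡ 0 z≤n)
⊛-cong (suc n) f≡ g≡ = cong₂ ℤ._+_ (cong₂ ℤ._*_ (f≡ 0 z≤n) (g≡ (suc n) ≤-refl))
  (⊛-cong n (λ i i≤n → f≡ (suc i) (s≤s i≤n)) (λ i i≤n → g≡ i (m≤n⇒m≤1+n i≤n)))

⊛-distribʳ-⊕ : ∀ h f g → (f ⊕ g) ⊛ h ≗ f ⊛ h ⊕ g ⊛ h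
⊛-distribʳ-⊕ h f g zero    = ℤₚ.*-distribʳ-+ (h 0) (f 0) (g 0)
⊛-distribʳ-⊕ h f g (suc n) = trans (cong (ℤ._+_ ((f 0 ℤ.+ g 0) ℤ.* h (suc n))) (⊛-distribʳ-⊕ h (f ∘ suc) (g ∘ suc) n))
  (arith (f 0) (g 0) (h (suc n)) _ _)
  where
  arith : ∀ a b c d e → (a ℤ.+ b) ℤ.* c ℤ.+ (d ℤ.+ e) ≡ a ℤ.* c ℤ.+ d ℤ.+ (b ℤ.* c ℤ.+ e)
  arith = ℤ-Solver.solve-∀

⊛-scaleˡ : ∀ c f g → (λ i → c ℤ.* f i) ⊛ g ≗ λ n → c ℤ.* (f ⊛ g) n
⊛-scaleˡ c f g zero    = ℤₚ.*-assoc c (f 0) (g 0)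
⊛-scaleˡ c f g (suc n) = trans (cong (ℤ._+_ (c ℤ.* f 0 ℤ.* g (suc n))) (⊛-scaleˡ c (f ∘ suc) g n)) (arith c (f 0) (g (suc n)) _)
  where
  arith : ∀ a b c d → a ℤ.* b ℤ.* c ℤ.+ a ℤ.* d ≡ a ℤ.* (b ℤ.* c ℤ.+ d)
  arith = ℤ-Solver.solve-∀

⊛-assoc : ∀ f g h → (f ⊛ g) ⊛ h ≗ f ⊛ (g ⊛ h)
⊛-assoc f g h zero    = ℤₚ.*-assoc (f 0) (g 0) (h 0)
⊛-assoc f g h (suc n) = begin
  f 0 ℤ.* g 0 ℤ.* h (suc n) ℤ.+ (((λ i → f 0 ℤ.* g (suc i)) ⊕ (f ∘ suc ⊛ g)) ⊛ h) n
    ≡⟨ cong (ℤ._+_ (f 0 ℤ.* g 0 ℤ.* h (suc n))) (⊛-distribʳ-⊕ h (λ i → f 0 ℤ.* g (suc i)) (f ∘ suc ⊛ g) n) ⟩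
  f 0 ℤ.* g 0 ℤ.* h (suc n) ℤ.+ (((λ i → f 0 ℤ.* g (suc i)) ⊛ h) n ℤ.+ ((f ∘ suc ⊛ g) ⊛ h) n)
    ≡⟨ cong (ℤ._+_ (f 0 ℤ.* g 0 ℤ.* h (suc n))) (cong₂ ℤ._+_ (⊛-scaleˡ (f 0) (g ∘ suc) h n) (⊛-assoc (f ∘ suc) g h n)) ⟩
  f 0 ℤ.* g 0 ℤ.* h (suc n) ℤ.+ (f 0 ℤ.* (g ∘ suc ⊛ h) n ℤ.+ (f ∘ suc ⊛ (g ⊛ h)) n)
    ≡⟨ arith (f 0) (g 0) (h (suc n)) _ _ ⟩
  f 0 ℤ.* (g 0 ℤ.* h (suc n) ℤ.+ (g ∘ suc ⊛ h) n) ℤ.+ (f ∘ suc ⊛ (g ⊛ h)) n ∎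
  where
  open ≡-Reasoning
  arith : ∀ a b c d e → a ℤ.* b ℤ.* c ℤ.+ (a ℤ.* d ℤ.+ e) ≡ a ℤ.* (b ℤ.* c ℤ.+ d) ℤ.+ e
  arith = ℤ-Solver.solve-∀

-- The mirror image of the defining recursion, splitting the second factor; commutativity follows by
-- comparing the two.
⊛-suc : ∀ f g n → (f ⊛ g) (suc n) ≡ g 0 ℤ.* f (suc n) ℤ.+ (f ⊛ g ∘ suc) n
⊛-suc f g zero    = arith (f 0) (g 1) (f 1) (g 0)
  where
  arith : ∀ a b c d → a ℤ.* b ℤ.+ c ℤ.* d ≡ d ℤ.* c ℤ.+ a ℤ.* b
  arith = ℤ-Solver.solve-∀
⊛-suc f g (suc n) = trans (cong (ℤ._+_ (f 0 ℤ.* g (suc (suc n)))) (⊛-suc (f ∘ suc) g n)) (arith (f 0) (g (suc (suc n))) (g 0) (f (suc (suc n))) _)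
  where
  arith : ∀ a b c d e → a ℤ.* b ℤ.+ (c ℤ.* d ℤ.+ e) ≡ c ℤ.* d ℤ.+ (a ℤ.* b ℤ.+ e)
  arith = ℤ-Solver.solve-∀

⊛-comm : ∀ f g → f ⊛ g ≗ g ⊛ f
⊛-comm f g zero    = ℤₚ.*-comm (f 0) (g 0)
⊛-comm f g (suc n) = trans (cong (ℤ._+_ (f 0 ℤ.* g (suc n))) (⊛-comm (f ∘ suc) g n)) (sym (⊛-suc g f n))

⊛-zeroˡ : ∀ f → zeroˢ ⊛ f ≗ zeroˢ
⊛-zeroˡ f zero    = refl
⊛-zeroˡ f (suc n) = cong (ℤ._+_ 0ℤ) (⊛-zeroˡ f n)

⊛-identityˡ : ∀ f → oneˢ ⊛ f ≗ f
⊛-identityˡ f zero    = ℤₚ.*-identityˡ (f 0)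
⊛-identityˡ f (suc n) = trans (cong₂ ℤ._+_ (ℤₚ.*-identityˡ (f (suc n))) (⊛-zeroˡ f n)) (ℤₚ.+-identityʳ _)

-- ℤ[[x]] / (x ^ (N + 1)): series are compared up to the coefficient of x ^ N.
truncated : ℕ → CommutativeRing 0ℓ 0ℓ
truncated N = record
  { Carrier = Series
  ; _≈_     = λ f g → ∀ i → i ≤ N → f i ≡ g i
  ; _+_     = _⊕_
  ; _*_     = _⊛_
  ; -_      = negate
  ; 0#      = zeroˢ
  ; 1#      = oneˢ
  ; isCommutativeRing = record
    { isRing = record
      { +-isAbelianGroup = record
        { isGroup = record
          { isMonoid = record
            { isSemigroup = record
              { isMagma = record
                { isEquivalence = record
                  { refl  = λ _ _ → refl
                  ; sym   = λ f≈g i i≤N → sym (f≈g i i≤N)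
                  ; trans = λ f≈g g≈h i i≤N → trans (f≈g i i≤N) (g≈h i i≤N)
                  }
                ; ∙-cong = λ f≈ g≈ i i≤N → cong₂ ℤ._+_ (f≈ i i≤N) (g≈ i i≤N)
                }
              ; assoc = λ f g h i _ → ℤₚ.+-assoc (f i) (g i) (h i)
              }
            ; identity = (λ f i _ → ℤₚ.+-identityˡ (f i)) , λ f i _ → ℤₚ.+-identityʳ (f i)
            }
          ; inverse = (λ f i _ → ℤₚ.+-inverseˡ (f i)) , λ f i _ → ℤₚ.+-inverseʳ (f i)
          ; ⁻¹-cong = λ f≈ i i≤N → cong ℤ.-_ (f≈ i i≤N)
          }
        ; comm = λ f g i _ → ℤₚ.+-comm (f i) (g i)
        }
      ; *-cong     = λ f≈ g≈ i i≤N → ⊛-cong i (λ j j≤i → f≈ j (≤-trans j≤i i≤N)) (λ j j≤i → g≈ j (≤-trans j≤i i≤N))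
      ; *-assoc    = λ f g h i _ → ⊛-assoc f g h i
      ; *-identity = (λ f i _ → ⊛-identityˡ f i) , λ f i _ → trans (⊛-comm f oneˢ i) (⊛-identityˡ f i)
      ; distrib    = (λ h f g i _ → trans (⊛-comm h (f ⊕ g) i) (trans (⊛-distribʳ-⊕ h f g i)
                       (cong₂ ℤ._+_ (⊛-comm f h i) (⊛-comm g h i)))) ,
                     λ h f g i _ → ⊛-distribʳ-⊕ h f g i
      }
    ; *-comm = λ f g i _ → ⊛-comm f g i
    }
  }

-- Shifts, powers of the variable and the substitution of its square

module _ {a} {A : Set a} where

  -- With the default `0ℤ` this is multiplication by x ^ k. The type is kept general so that the
  -- same shift, with default `[]`, acts on families of lists of partitions.
  delay : A → ℕ → (ℕ → A) → ℕ → A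
  delay d zero    f n       = f n
  delay d (suc k) f zero    = d
  delay d (suc k) f (suc n) = delay d k f n

  delay-cong : ∀ d k {f g} → f ≗ g → delay d k f ≗ delay d k g
  delay-cong d zero    f≗g n       = f≗g n
  delay-cong d (suc k) f≗g zero    = refl
  delay-cong d (suc k) f≗g (suc n) = delay-cong d k f≗g n

  delay-< : ∀ d k f {n} → n < k → delay d k f n ≡ d
  delay-< d (suc k) f {zero}  _         = refl
  delay-< d (suc k) f {suc n} (s≤s n<k) = delay-< d k f n<k

  delay-+ : ∀ d k f n → delay d k f (k ℕ.+ n) ≡ f n
  delay-+ d zero    f n = refl
  delay-+ d (suc k) f n = delay-+ d k f n

  delay-pred : ∀ {p} (P : Pred A p) {d} k {f} → P d → (∀ n → P (f n)) → ∀ n → P (delay d k f n)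
  delay-pred P zero    Pd Pf n       = Pf n
  delay-pred P (suc k) Pd Pf zero    = Pd
  delay-pred P (suc k) Pd Pf (suc n) = delay-pred P k Pd Pf n

delay-map : ∀ {a b} {A : Set a} {B : Set b} (φ : A → B) d k f → φ ∘ delay d k f ≗ delay (φ d) k (φ ∘ f)
delay-map φ d zero    f n       = refl
delay-map φ d (suc k) f zero    = refl
delay-map φ d (suc k) f (suc n) = delay-map φ d k f n

X⊛ : ∀ f → X ⊛ f ≗ delay 0ℤ 1 f
X⊛ f zero    = refl
X⊛ f (suc n) = trans (ℤₚ.+-identityˡ _) (⊛-identityˡ f n)

delay-suc : ∀ k (f : Series) → delay 0ℤ 1 (delay 0ℤ k f) ≗ delay 0ℤ (suc k) f
delay-suc k f zero    = refl
delay-suc k f (suc n) = refl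

module Powers (N : ℕ) where
  open Exponentiation (CommutativeRing.semiring (truncated N)) public using (_^_)

  X^⊛ : ∀ k f → X ^ k ⊛ f ≗ delay 0ℤ k f
  X^⊛ zero    f n = ⊛-identityˡ f n
  X^⊛ (suc k) f n = begin
    (X ⊛ X ^ k ⊛ f) n              ≡⟨ ⊛-assoc X (X ^ k) f n ⟩
    (X ⊛ (X ^ k ⊛ f)) n            ≡⟨ X⊛ (X ^ k ⊛ f) n ⟩
    delay 0ℤ 1 (X ^ k ⊛ f) n       ≡⟨ delay-cong 0ℤ 1 (X^⊛ k f) n ⟩
    delay 0ℤ 1 (delay 0ℤ k f) n    ≡⟨ delay-suc k f n ⟩
    delay 0ℤ (suc k) f n           ∎
    where open ≡-Reasoning

  X^-< : ∀ k i → i < k → (X ^ k) i ≡ 0ℤ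
  X^-< k i i<k = begin
    (X ^ k) i            ≡⟨ ⊛-identityˡ (X ^ k) i ⟨
    (oneˢ ⊛ X ^ k) i     ≡⟨ ⊛-comm oneˢ (X ^ k) i ⟩
    (X ^ k ⊛ oneˢ) i     ≡⟨ X^⊛ k oneˢ i ⟩
    delay 0ℤ k oneˢ i    ≡⟨ delay-< 0ℤ k oneˢ i<k ⟩
    0ℤ                   ∎
    where open ≡-Reasoning

-- The substitution of x ^ 2 for x.
dilate : Series → Series
dilate f zero          = f 0
dilate f (suc zero)    = 0ℤ
dilate f (suc (suc n)) = dilate (f ∘ suc) n

dilate-cong : ∀ {f g} → f ≗ g → dilate f ≗ dilate g
dilate-cong f≗g zero          = f≗g 0
dilate-cong f≗g (suc zero)    = refl
dilate-cong f≗g (suc (suc n)) = dilate-cong (f≗g ∘ suc) n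

dilate-⊕ : ∀ f g → dilate (f ⊕ g) ≗ dilate f ⊕ dilate g
dilate-⊕ f g zero          = refl
dilate-⊕ f g (suc zero)    = refl
dilate-⊕ f g (suc (suc n)) = dilate-⊕ (f ∘ suc) (g ∘ suc) n

dilate-zero : dilate zeroˢ ≗ zeroˢ
dilate-zero zero          = refl
dilate-zero (suc zero)    = refl
dilate-zero (suc (suc n)) = dilate-zero n

dilate-one : dilate oneˢ ≗ oneˢ
dilate-one zero          = refl
dilate-one (suc zero)    = refl
dilate-one (suc (suc n)) = dilate-zero n

dilate-delay : ∀ k f → dilate (delay 0ℤ k f) ≗ delay 0ℤ (k ℕ.* 2) (dilate f)
dilate-delay zero    f n             = refl
dilate-delay (suc k) f zero          = refl
dilate-delay (suc k) f (suc zero)    = refl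
dilate-delay (suc k) f (suc (suc n)) = dilate-delay k f n

dilate-double : ∀ f r → dilate f (r ℕ.* 2) ≡ f r
dilate-double f zero    = refl
dilate-double f (suc r) = dilate-double (f ∘ suc) r

dilate-vanish : ∀ f n → (∀ r → n ≢ r ℕ.* 2) → dilate f n ≡ 0ℤ
dilate-vanish f zero          n≢ = contradiction refl (n≢ 0)
dilate-vanish f (suc zero)    n≢ = refl
dilate-vanish f (suc (suc n)) n≢ = dilate-vanish (f ∘ suc) n λ r n≡ → n≢ (suc r) (cong (suc ∘ suc) n≡)

-- The hypothesis on `f 0` covers the index n = t, just as `S` vanishes at 0.
delay-dilate-vanish : ∀ t f n → f 0 ≡ 0ℤ → (∀ r → n ≢ t ℕ.+ suc r ℕ.* 2) → delay 0ℤ t (dilate f) n ≡ 0ℤ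
delay-dilate-vanish zero    f zero          f₀ n≢ = f₀
delay-dilate-vanish zero    f (suc zero)    f₀ n≢ = refl
delay-dilate-vanish zero    f (suc (suc n)) f₀ n≢ = dilate-vanish (f ∘ suc) n λ r n≡ → n≢ r (cong (suc ∘ suc) n≡)
delay-dilate-vanish (suc t) f zero          f₀ n≢ = refl
delay-dilate-vanish (suc t) f (suc n)       f₀ n≢ = delay-dilate-vanish t f n f₀ λ r n≡ → n≢ r (cong suc n≡)

-- Recurrences for lists of partitions

module _ {a b p q} {A : Set a} {B : Set b} {P : Pred B p} {Q : Pred A q}
         (P? : Decidable P) (Q? : Decidable Q) (f : A → B) where

  -- The equivalence is demanded only on the elements of `xs`, because for distinct parts it rests
  -- on the bound on the parts of the listed partitions.
  filter-map : ∀ {xs} → All (λ x → (P (f x) → Q x) × (Q x → P (f x))) xs → filter P? (map f xs) ≡ map f (filter Q? xs)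
  filter-map [] = refl
  filter-map {x ∷ xs} ((to , from) ∷ rest) with Q? x
  ... | yes Qx = trans (filter-accept P? (from Qx)) (cong (f x ∷_) (filter-map rest))
  ... | no ¬Qx = trans (filter-reject P? (¬Qx ∘ to)) (filter-map rest)

module _ (m : ℕ) where

  private
    k = suc m

    fits? : ∀ n → Decidable (λ j → j ℕ.* k ≤ n)
    fits? n j = j ℕ.* k ≤? n

    block : ℕ → ℕ → List (List ℕ)
    block n j = map (replicate j k ++_) (partitionsUpTo m (n ∸ j ℕ.* k))

    blocks-map-suc : ∀ n js → concatMap (block (k ℕ.+ n)) (filter (fits? (k ℕ.+ n)) (map suc js))
                            ≡ map (k ∷_) (concatMap (block n) (filter (fits? n) js))
    blocks-map-suc n js = begin
      concatMap (block (k ℕ.+ n)) (filter (fits? (k ℕ.+ n)) (map suc js))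
        ≡⟨ cong (concatMap (block (k ℕ.+ n))) (filter-map (fits? (k ℕ.+ n)) (fits? n) suc
             (All.universal (λ j → +-cancelˡ-≤ k (j ℕ.* k) n , +-monoʳ-≤ k) js)) ⟩
      concatMap (block (k ℕ.+ n)) (map suc (filter (fits? n) js))
        ≡⟨ concatMap-map (block (k ℕ.+ n)) suc (filter (fits? n) js) ⟩
      concatMap (block (k ℕ.+ n) ∘ suc) (filter (fits? n) js)
        ≡⟨ concatMap-cong block-suc (filter (fits? n) js) ⟩
      concatMap (map (k ∷_) ∘ block n) (filter (fits? n) js)
        ≡⟨ map-concatMap (k ∷_) (block n) (filter (fits? n) js) ⟨
      map (k ∷_) (concatMap (block n) (filter (fits? n) js)) ∎
      where
      open ≡-Reasoning
      block-suc : ∀ j → block (k ℕ.+ n) (suc j) ≡ map (k ∷_) (block n j)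
      block-suc j = trans
        (cong (map (replicate (suc j) k ++_) ∘ partitionsUpTo m) ([m+n]∸[m+o]≡n∸o k n (j ℕ.* k)))
        (map-∘ (partitionsUpTo m (n ∸ j ℕ.* k)))

    -- A multiplicity above n never fits, since `k` is positive. This reconciles the range of
    -- multiplicities inherited from k + n with the one used for n.
    fits-upTo : ∀ n i → filter (fits? n) (upTo (i ℕ.+ suc n)) ≡ filter (fits? n) (upTo (suc n))
    fits-upTo n zero    = refl
    fits-upTo n (suc i) = begin
      filter (fits? n) (upTo (suc M))                          ≡⟨ cong (filter (fits? n)) (upTo-∷ʳ M) ⟨
      filter (fits? n) (upTo M ++ M ∷ [])                      ≡⟨ filter-++ (fits? n) (upTo M) (M ∷ []) ⟩
      filter (fits? n) (upTo M) ++ filter (fits? n) (M ∷ [])   ≡⟨ cong₂ _++_ (fits-upTo n i) (filter-reject (fits? n) {M} {[]} (<⇒≱ n<M*k)) ⟩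
      filter (fits? n) (upTo (suc n)) ++ []                    ≡⟨ ++-identityʳ _ ⟩
      filter (fits? n) (upTo (suc n))                          ∎
      where
      open ≡-Reasoning
      M = i ℕ.+ suc n
      n<M*k : n < M ℕ.* k
      n<M*k = ≤-trans (m≤n+m (suc n) i) (m≤m*n M k)

    partitionsUpTo-suc′ : ∀ n → partitionsUpTo k n ≡
      partitionsUpTo m n ++ concatMap (block n) (filter (fits? n) (map suc (upTo n)))
    partitionsUpTo-suc′ n = cong₂ (λ xs js → xs ++ concatMap (block n) (filter (fits? n) js))
      (map-id (partitionsUpTo m n)) (sym (map-upTo suc n))

  -- The definition branches on the multiplicity of `suc m`, whereas generating functions need the
  -- branch on whether it occurs. A partition containing it loses one copy; the lists agree even in
  -- their order, so lengths and totals carry over by congruence.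
  partitionsUpTo-suc : ∀ n → partitionsUpTo (suc m) n ≡
    partitionsUpTo m n ++ delay [] (suc m) (map (suc m ∷_) ∘ partitionsUpTo (suc m)) n
  partitionsUpTo-suc n with n <? k
  ... | yes n<k = trans (partitionsUpTo-suc′ n) (cong (partitionsUpTo m n ++_) (trans
    (cong (concatMap (block n)) (filter-none (fits? n)
      (Allₚ.map⁺ (All.universal (λ j → <⇒≱ (<-≤-trans n<k (m≤m+n k (j ℕ.* k)))) (upTo n)))))
    (sym (delay-< [] k _ n<k))))
  ... | no n≮k with r , refl ← m≤n⇒∃[o]m+o≡n (≮⇒≥ n≮k) =
    trans (partitionsUpTo-suc′ (k ℕ.+ r)) (cong (partitionsUpTo m (k ℕ.+ r) ++_) (begin
      concatMap (block (k ℕ.+ r)) (filter (fits? (k ℕ.+ r)) (map suc (upTo (k ℕ.+ r))))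
        ≡⟨ blocks-map-suc r (upTo (k ℕ.+ r)) ⟩
      map (k ∷_) (concatMap (block r) (filter (fits? r) (upTo (k ℕ.+ r))))
        ≡⟨ cong (λ M → map (k ∷_) (concatMap (block r) (filter (fits? r) (upTo M)))) (+-suc m r) ⟨
      map (k ∷_) (concatMap (block r) (filter (fits? r) (upTo (m ℕ.+ suc r))))
        ≡⟨ cong (map (k ∷_) ∘ concatMap (block r)) (fits-upTo r m) ⟩
      map (k ∷_) (partitionsUpTo k r)
        ≡⟨ delay-+ [] k (map (k ∷_) ∘ partitionsUpTo k) r ⟨
      delay [] k (map (k ∷_) ∘ partitionsUpTo k) (k ℕ.+ r) ∎))
    where open ≡-Reasoning

partitionsUpTo-stable : ∀ {m n} → n ≤ m → partitionsUpTo m n ≡ partitions n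
partitionsUpTo-stable {zero}  {zero} z≤n = refl
partitionsUpTo-stable {suc m} {n} n≤1+m with n ≟ suc m
... | yes refl = refl
... | no n≢1+m = begin
  partitionsUpTo (suc m) n    ≡⟨ partitionsUpTo-suc m n ⟩
  partitionsUpTo m n ++ delay [] (suc m) (map (suc m ∷_) ∘ partitionsUpTo (suc m)) n
                              ≡⟨ cong (partitionsUpTo m n ++_) (delay-< [] (suc m) _ n<1+m) ⟩
  partitionsUpTo m n ++ []    ≡⟨ ++-identityʳ _ ⟩
  partitionsUpTo m n          ≡⟨ partitionsUpTo-stable (ℕ.s≤s⁻¹ n<1+m) ⟩
  partitions n                ∎
  where
  open ≡-Reasoning
  n<1+m = ≤∧≢⇒< n≤1+m n≢1+m

oddPartitionsUpTo distinctPartitionsUpTo : ℕ → ℕ → List (List ℕ)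
oddPartitionsUpTo      m = filter (all? odd?) ∘ partitionsUpTo m
distinctPartitionsUpTo m = filter unique? ∘ partitionsUpTo m

module _ {p} {P : Pred (List ℕ) p} (P? : Decidable P) (m : ℕ) where

  filter-partitionsUpTo-suc : ∀ n → filter P? (partitionsUpTo (suc m) n) ≡
    filter P? (partitionsUpTo m n) ++ delay [] (suc m) (filter P? ∘ map (suc m ∷_) ∘ partitionsUpTo (suc m)) n
  filter-partitionsUpTo-suc n = begin
    filter P? (partitionsUpTo (suc m) n)
      ≡⟨ cong (filter P?) (partitionsUpTo-suc m n) ⟩
    filter P? (partitionsUpTo m n ++ delay [] (suc m) (map (suc m ∷_) ∘ partitionsUpTo (suc m)) n)
      ≡⟨ filter-++ P? (partitionsUpTo m n) _ ⟩
    filter P? (partitionsUpTo m n) ++ filter P? (delay [] (suc m) (map (suc m ∷_) ∘ partitionsUpTo (suc m)) n)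
      ≡⟨ cong (filter P? (partitionsUpTo m n) ++_) (delay-map (filter P?) [] (suc m) _ n) ⟩
    filter P? (partitionsUpTo m n) ++ delay [] (suc m) (filter P? ∘ map (suc m ∷_) ∘ partitionsUpTo (suc m)) n ∎
    where open ≡-Reasoning

oddPartitionsUpTo-odd : ∀ m → Odd (suc m) → ∀ n → oddPartitionsUpTo (suc m) n ≡
  oddPartitionsUpTo m n ++ delay [] (suc m) (map (suc m ∷_) ∘ oddPartitionsUpTo (suc m)) n
oddPartitionsUpTo-odd m odd n = trans (filter-partitionsUpTo-suc (all? odd?) m n)
  (cong (oddPartitionsUpTo m n ++_) (delay-cong [] (suc m) (λ i →
    filter-map (all? odd?) (all? odd?) (suc m ∷_) (All.universal (λ _ → All.tail , (odd ∷_)) (partitionsUpTo (suc m) i))) n))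

oddPartitionsUpTo-even : ∀ m → ¬ Odd (suc m) → ∀ n → oddPartitionsUpTo (suc m) n ≡ oddPartitionsUpTo m n
oddPartitionsUpTo-even m even n = trans (filter-partitionsUpTo-suc (all? odd?) m n)
  (trans (cong (oddPartitionsUpTo m n ++_) (delay-pred (_≡ []) (suc m) refl (λ i →
    filter-none (all? odd?) (Allₚ.map⁺ (All.universal (λ _ → even ∘ All.head) (partitionsUpTo (suc m) i)))) n))
    (++-identityʳ _))

-- When one copy of `suc m` has been removed, the rest either has parts at most `m`, so that
-- restoring the copy preserves distinctness, or contains a second copy and is rejected. Hence the
-- bound drops to `m` after the removal.
distinctPartitionsUpTo-suc : ∀ m n → distinctPartitionsUpTo (suc m) n ≡
  distinctPartitionsUpTo m n ++ delay [] (suc m) (map (suc m ∷_) ∘ distinctPartitionsUpTo m) n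
distinctPartitionsUpTo-suc m n = trans (filter-partitionsUpTo-suc unique? m n)
  (cong (distinctPartitionsUpTo m n ++_) (delay-cong [] (suc m) once n))
  where
  open ≡-Reasoning
  twice : ℕ → List (List ℕ)
  twice = delay [] (suc m) (map (suc m ∷_) ∘ partitionsUpTo (suc m))
  once : ∀ i → filter unique? (map (suc m ∷_) (partitionsUpTo (suc m) i)) ≡ map (suc m ∷_) (distinctPartitionsUpTo m i)
  once i = begin
    filter unique? (map (suc m ∷_) (partitionsUpTo (suc m) i))
      ≡⟨ cong (filter unique? ∘ map (suc m ∷_)) (partitionsUpTo-suc m i) ⟩
    filter unique? (map (suc m ∷_) (partitionsUpTo m i ++ twice i))
      ≡⟨ cong (filter unique?) (map-++ (suc m ∷_) (partitionsUpTo m i) (twice i)) ⟩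
    filter unique? (map (suc m ∷_) (partitionsUpTo m i) ++ map (suc m ∷_) (twice i))
      ≡⟨ filter-++ unique? (map (suc m ∷_) (partitionsUpTo m i)) _ ⟩
    filter unique? (map (suc m ∷_) (partitionsUpTo m i)) ++ filter unique? (map (suc m ∷_) (twice i))
      ≡⟨ cong₂ _++_
           (filter-map unique? unique? (suc m ∷_) (All.tabulate λ ps∈ →
             (λ { (_ ∷ u) → u }) , (All.map (λ p≤m 1+m≡p → <-irrefl (sym 1+m≡p) (s≤s p≤m)) (proj₂ (partitionsUpTo-sound m i ps∈)) ∷_)))
           (filter-none unique? (Allₚ.map⁺ (delay-pred (All (λ ps → ¬ Unique (suc m ∷ ps))) (suc m) []
             (λ j → Allₚ.map⁺ (All.universal (λ { _ ((k≢k ∷ _) ∷ _) → k≢k refl }) (partitionsUpTo (suc m) j))) i))) ⟩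
    map (suc m ∷_) (distinctPartitionsUpTo m i) ++ []
      ≡⟨ ++-identityʳ _ ⟩
    map (suc m ∷_) (distinctPartitionsUpTo m i) ∎

-- Generating functions of families of partitions

count total : (ℕ → List (List ℕ)) → Series
count F n = + length (F n)
total F n = + totalParts (F n)

totalParts-++ : ∀ xs ys → totalParts (xs ++ ys) ≡ totalParts xs ℕ.+ totalParts ys
totalParts-++ xs ys = trans (cong sum (map-++ length xs ys)) (sum-++ (map length xs) (map length ys))

totalParts-map-∷ : ∀ k xs → totalParts (map (k ∷_) xs) ≡ length xs ℕ.+ totalParts xs
totalParts-map-∷ k []       = refl
totalParts-map-∷ k (x ∷ xs) = trans (cong (suc (length x) ℕ.+_) (totalParts-map-∷ k xs))
  (arith (length x) (length xs) (totalParts xs))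
  where
  arith : ∀ a b c → suc a ℕ.+ (b ℕ.+ c) ≡ suc b ℕ.+ (a ℕ.+ c)
  arith = solve-∀

⊕-delay⇒≈ : ∀ N k f g h → f ≗ g ⊕ delay 0ℤ k h →
  let open CommutativeRing (truncated N)
      open Powers N
  in f ≈ g + X ^ k * h
⊕-delay⇒≈ N k f g h f≗ i _ = trans (f≗ i) (cong (ℤ._+_ (g i)) (sym (Powers.X^⊛ N k h i)))

count-∅ : ∀ F → F 0 ≡ [] ∷ [] → (∀ i → F (suc i) ≡ []) → count F ≗ oneˢ
count-∅ F F₀ F₊ zero    = cong (+_ ∘ length) F₀
count-∅ F F₀ F₊ (suc i) = cong (+_ ∘ length) (F₊ i)

total-∅ : ∀ F → F 0 ≡ [] ∷ [] → (∀ i → F (suc i) ≡ []) → total F ≗ zeroˢ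
total-∅ F F₀ F₊ zero    = cong (+_ ∘ totalParts) F₀
total-∅ F F₀ F₊ (suc i) = cong (+_ ∘ totalParts) (F₊ i)

-- `H` lists what may remain after one part `k` is removed: it is `F` when `k` may be repeated and
-- `G` when `k` is used at most once.
module Recurrence (k : ℕ) (F G H : ℕ → List (List ℕ))
                  (F≗ : ∀ n → F n ≡ G n ++ delay [] k (map (k ∷_) ∘ H) n) where
  open ≡-Reasoning

  count-step : ∀ n → count F n ≡ (count G ⊕ delay 0ℤ k (count H)) n
  count-step n = begin
    + length (F n)
      ≡⟨ cong (+_ ∘ length) (F≗ n) ⟩
    + length (G n ++ delay [] k (map (k ∷_) ∘ H) n)
      ≡⟨ cong +_ (length-++ (G n)) ⟩
    + length (G n) ℤ.+ + length (delay [] k (map (k ∷_) ∘ H) n)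
      ≡⟨ cong (ℤ._+_ (+ length (G n))) (delay-map (+_ ∘ length) [] k _ n) ⟩
    + length (G n) ℤ.+ delay 0ℤ k (+_ ∘ length ∘ map (k ∷_) ∘ H) n
      ≡⟨ cong (ℤ._+_ (+ length (G n))) (delay-cong 0ℤ k (λ j → cong +_ (length-map (k ∷_) (H j))) n) ⟩
    + length (G n) ℤ.+ delay 0ℤ k (count H) n ∎

  total-step : ∀ n → total F n ≡ (total G ⊕ delay 0ℤ k (count H ⊕ total H)) n
  total-step n = begin
    + totalParts (F n)
      ≡⟨ cong (+_ ∘ totalParts) (F≗ n) ⟩
    + totalParts (G n ++ delay [] k (map (k ∷_) ∘ H) n)
      ≡⟨ cong +_ (totalParts-++ (G n) _) ⟩
    + totalParts (G n) ℤ.+ + totalParts (delay [] k (map (k ∷_) ∘ H) n)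
      ≡⟨ cong (ℤ._+_ (+ totalParts (G n))) (delay-map (+_ ∘ totalParts) [] k _ n) ⟩
    + totalParts (G n) ℤ.+ delay 0ℤ k (+_ ∘ totalParts ∘ map (k ∷_) ∘ H) n
      ≡⟨ cong (ℤ._+_ (+ totalParts (G n))) (delay-cong 0ℤ k (λ j → cong +_ (totalParts-map-∷ k (H j))) n) ⟩
    + totalParts (G n) ℤ.+ delay 0ℤ k (count H ⊕ total H) n ∎

  dilate-step : ∀ f g h → f ≗ g ⊕ delay 0ℤ k h → dilate f ≗ dilate g ⊕ delay 0ℤ (k ℕ.* 2) (dilate h)
  dilate-step f g h f≗ n = trans (dilate-cong f≗ n)
    (trans (dilate-⊕ g (delay 0ℤ k h) n) (cong (ℤ._+_ (dilate g n)) (dilate-delay k h n)))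

  module _ (N : ℕ) where
    open CommutativeRing (truncated N) using (_≈_; _+_; _*_)
    open Powers N

    count-≈ : count F ≈ count G + X ^ k * count H
    count-≈ = ⊕-delay⇒≈ N k (count F) (count G) (count H) count-step

    total-≈ : total F ≈ total G + X ^ k * (count H + total H)
    total-≈ = ⊕-delay⇒≈ N k (total F) (total G) (count H ⊕ total H) total-step

    dilate-count-≈ : dilate (count F) ≈ dilate (count G) + X ^ (k ℕ.* 2) * dilate (count H)
    dilate-count-≈ = ⊕-delay⇒≈ N (k ℕ.* 2) (dilate (count F)) (dilate (count G)) (dilate (count H))
      (dilate-step (count F) (count G) (count H) count-step)

    dilate-total-≈ : dilate (total F) ≈ dilate (total G) + X ^ (k ℕ.* 2) * (dilate (count H) + dilate (total H))
    dilate-total-≈ i i≤N = trans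
      (⊕-delay⇒≈ N (k ℕ.* 2) (dilate (total F)) (dilate (total G)) (dilate (count H ⊕ total H))
        (dilate-step (total F) (total G) (count H ⊕ total H) total-step) i i≤N)
      (cong (ℤ._+_ (dilate (total G) i)) (⊛-cong i (λ _ _ → refl) λ j _ → dilate-⊕ (count H) (total H) j))

odd-suc-double : ∀ j → Odd (suc (j ℕ.* 2))
odd-suc-double j 2∣ = contradiction
  (∣1⇒≡1 (∣m+n∣m⇒∣n (subst (2 ∣_) (+-comm 1 (j ℕ.* 2)) 2∣) (divides j refl))) λ ()

-- Raising the bound by two admits one new odd part, so that `j` numbers the odd parts consecutively
-- as `Repeated` requires.
oddPartitionsUpTo-double : ∀ j n → oddPartitionsUpTo (suc j ℕ.* 2) n ≡
  oddPartitionsUpTo (j ℕ.* 2) n ++ delay [] (suc (j ℕ.* 2)) (map (suc (j ℕ.* 2) ∷_) ∘ oddPartitionsUpTo (suc j ℕ.* 2)) n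
oddPartitionsUpTo-double j n = trans (even n) (trans (oddPartitionsUpTo-odd (j ℕ.* 2) (odd-suc-double j) n)
  (cong (oddPartitionsUpTo (j ℕ.* 2) n ++_)
        (delay-cong [] (suc (j ℕ.* 2)) (λ i → cong (map (suc (j ℕ.* 2) ∷_)) (sym (even i))) n)))
  where
  even : ∀ i → oddPartitionsUpTo (suc j ℕ.* 2) i ≡ oddPartitionsUpTo (suc (j ℕ.* 2)) i
  even = oddPartitionsUpTo-even (suc (j ℕ.* 2)) λ odd → odd (divides (suc j) refl)

-- From the ring identity to a sum of coefficients

partialSum-suc : ∀ f M → partialSum f (suc M) ≡ partialSum f M ℤ.+ f M
partialSum-suc f zero    = ℤₚ.+-comm (f 0) 0ℤ
partialSum-suc f (suc M) = trans (cong (ℤ._+_ (f 0)) (partialSum-suc (f ∘ suc) M)) (sym (ℤₚ.+-assoc (f 0) _ (f (suc M))))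

partialSum-cong : ∀ {f g} → f ≗ g → ∀ M → partialSum f M ≡ partialSum g M
partialSum-cong f≗g zero    = refl
partialSum-cong f≗g (suc M) = cong₂ ℤ._+_ (f≗g 0) (partialSum-cong (f≗g ∘ suc) M)

partialSum-stable : ∀ f N → (∀ k → N ≤ k → f k ≡ 0ℤ) → ∀ j → partialSum f (N ℕ.+ j) ≡ partialSum f N
partialSum-stable f N f≡0 zero    = cong (partialSum f) (+-identityʳ N)
partialSum-stable f N f≡0 (suc j) = begin
  partialSum f (N ℕ.+ suc j)                 ≡⟨ cong (partialSum f) (+-suc N j) ⟩
  partialSum f (suc (N ℕ.+ j))               ≡⟨ partialSum-suc f (N ℕ.+ j) ⟩
  partialSum f (N ℕ.+ j) ℤ.+ f (N ℕ.+ j)     ≡⟨ cong₂ ℤ._+_ (partialSum-stable f N f≡0 j) (f≡0 (N ℕ.+ j) (m≤m+n N j)) ⟩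
  partialSum f N ℤ.+ 0ℤ                      ≡⟨ ℤₚ.+-identityʳ _ ⟩
  partialSum f N                             ∎
  where open ≡-Reasoning

module _ (N : ℕ) where
  open FiniteSums (truncated N) using (∑)

  ∑-⊛ : ∀ f g n M → (∑ f M ⊛ g) n ≡ partialSum (λ s → (f s ⊛ g) n) M
  ∑-⊛ f g n zero    = ⊛-zeroˡ g n
  ∑-⊛ f g n (suc M) = begin
    ((∑ f M ⊕ f M) ⊛ g) n                                        ≡⟨ ⊛-distribʳ-⊕ g (∑ f M) (f M) n ⟩
    (∑ f M ⊛ g) n ℤ.+ (f M ⊛ g) n                                ≡⟨ cong (ℤ._+ (f M ⊛ g) n) (∑-⊛ f g n M) ⟩
    partialSum (λ s → (f s ⊛ g) n) M ℤ.+ (f M ⊛ g) n             ≡⟨ partialSum-suc (λ s → (f s ⊛ g) n) M ⟨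
    partialSum (λ s → (f s ⊛ g) n) (suc M)                       ∎
    where open ≡-Reasoning

module _ (n : ℕ) where

  private
    L = suc n
    N = L ℕ.* 2

  open CommutativeRing (truncated N) using (_*_; _-_)
  open Powers N
  open FiniteSums (truncated N) using (∑)
  open NilpotentIdentities (truncated N) X n (λ i i≤N → X^-< (suc N) i (s≤s i≤N)) using (Repeated; Distinct; total-difference)

  odd-recurrences : Repeated (λ j → suc (j ℕ.* 2))
    (λ j → count (oddPartitionsUpTo (j ℕ.* 2))) (λ j → total (oddPartitionsUpTo (j ℕ.* 2)))
  odd-recurrences = record
    { count-zero = λ i _ → count-∅ (oddPartitionsUpTo 0) refl (λ _ → refl) i
    ; count-suc  = λ j → R.count-≈ j N
    ; total-zero = λ i _ → total-∅ (oddPartitionsUpTo 0) refl (λ _ → refl) i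
    ; total-suc  = λ j → R.total-≈ j N
    }
    where
    module R j = Recurrence (suc (j ℕ.* 2)) (oddPartitionsUpTo (suc j ℕ.* 2)) (oddPartitionsUpTo (j ℕ.* 2))
                            (oddPartitionsUpTo (suc j ℕ.* 2)) (oddPartitionsUpTo-double j)

  distinct-recurrences : Distinct suc (λ j → count (distinctPartitionsUpTo j)) (λ j → total (distinctPartitionsUpTo j))
  distinct-recurrences = record
    { count-zero = λ i _ → count-∅ (distinctPartitionsUpTo 0) refl (λ _ → refl) i
    ; count-suc  = λ j → R.count-≈ j N
    ; total-zero = λ i _ → total-∅ (distinctPartitionsUpTo 0) refl (λ _ → refl) i
    ; total-suc  = λ j → R.total-≈ j N
    }
    where
    module R j = Recurrence (suc j) (distinctPartitionsUpTo (suc j)) (distinctPartitionsUpTo j)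
                            (distinctPartitionsUpTo j) (distinctPartitionsUpTo-suc j)

  -- Replacing x by its square makes the part j + 1 weigh 2 j + 2 without changing the number of
  -- parts.
  even-recurrences : Repeated (λ j → suc j ℕ.* 2)
    (λ j → dilate (count (partitionsUpTo j))) (λ j → dilate (total (partitionsUpTo j)))
  even-recurrences = record
    { count-zero = λ i _ → trans (dilate-cong (count-∅ (partitionsUpTo 0) refl (λ _ → refl)) i) (dilate-one i)
    ; count-suc  = λ j → R.dilate-count-≈ j N
    ; total-zero = λ i _ → trans (dilate-cong (total-∅ (partitionsUpTo 0) refl (λ _ → refl)) i) (dilate-zero i)
    ; total-suc  = λ j → R.dilate-total-≈ j N
    }
    where
    module R j = Recurrence (suc j) (partitionsUpTo (suc j)) (partitionsUpTo j)
                            (partitionsUpTo (suc j)) (partitionsUpTo-suc j)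

  b-sum : b n ≡ partialSum (λ s → delay 0ℤ (triangle s) (dilate (total (partitionsUpTo L))) n) N
  b-sum = begin
    b n
      -- As n ≤ N, the bound N on the parts excludes no partition of n.
      ≡⟨ cong₂ (λ ps qs → + totalParts (filter _ ps) ℤ.- + totalParts (filter _ qs)) (partitionsUpTo-stable n≤N) (partitionsUpTo-stable n≤N) ⟨
    (total (oddPartitionsUpTo N) - total (distinctPartitionsUpTo N)) n
      ≡⟨ total-difference odd-recurrences distinct-recurrences even-recurrences n n≤N ⟩
    (∑ (λ s → X ^ triangle s) N * dilate (total (partitionsUpTo L))) n
      ≡⟨ ∑-⊛ N (λ s → X ^ triangle s) _ n N ⟩
    partialSum (λ s → (X ^ triangle s * dilate (total (partitionsUpTo L))) n) N
      ≡⟨ partialSum-cong (λ s → X^⊛ (triangle s) (dilate (total (partitionsUpTo L))) n) N ⟩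
    partialSum (λ s → delay 0ℤ (triangle s) (dilate (total (partitionsUpTo L))) n) N ∎
    where
    open ≡-Reasoning
    n≤N : n ≤ N
    n≤N = ≤-trans (n≤1+n n) (m≤m*n L 2)

-- The rational arguments of `S`

triangle-double : ∀ k → k ℕ.* (k ℕ.+ 1) ≡ triangle k ℕ.* 2
triangle-double zero    = refl
triangle-double (suc k) = trans (arith₁ k) (trans (cong (λ t → t ℕ.+ suc k ℕ.* 2) (triangle-double k)) (arith₂ k (triangle k)))
  where
  arith₁ : ∀ k → suc k ℕ.* (suc k ℕ.+ 1) ≡ k ℕ.* (k ℕ.+ 1) ℕ.+ suc k ℕ.* 2
  arith₁ = solve-∀
  arith₂ : ∀ k t → t ℕ.* 2 ℕ.+ suc k ℕ.* 2 ≡ (suc k ℕ.+ t) ℕ.* 2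
  arith₂ = solve-∀

n≤triangle : ∀ n → n ≤ triangle n
n≤triangle zero    = z≤n
n≤triangle (suc n) = m≤m+n (suc n) (triangle n)

argument : ℕ → ℕ → ℚ
argument n m = + n ℚ./ 2 ℚ.- + m ℚ./ 4

-- Reduction to lowest terms is stuck on variables; unnormalised fractions compute and leave an
-- integer equation.
argument-≃ : ∀ n m → toℚᵘ (argument n m) ≃ mkℚᵘ (+ n) 1 ℚᵘ.- mkℚᵘ (+ m) 3
argument-≃ n m = ℚᵘₚ.≃-trans (ℚₚ.toℚᵘ-homo-+ (+ n ℚ./ 2) (ℚ.- (+ m ℚ./ 4)))
  (ℚᵘₚ.+-cong (ℚₚ.toℚᵘ-fromℚᵘ (mkℚᵘ (+ n) 1))
              (ℚᵘₚ.≃-trans (ℚₚ.toℚᵘ-homo‿- (+ m ℚ./ 4)) (ℚᵘₚ.-‿cong (ℚₚ.toℚᵘ-fromℚᵘ (mkℚᵘ (+ m) 3)))))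

argument-≃⇒ : ∀ n t r → toℚᵘ (argument n (t ℕ.* 2)) ≃ mkℚᵘ (+ r) 0 → n ≡ t ℕ.+ r ℕ.* 2
argument-≃⇒ n t r eq with ℚᵘₚ.≃-trans (ℚᵘₚ.≃-sym (argument-≃ n (t ℕ.* 2))) eq
... | *≡* e = ℤₚ.+-injective (trans (ℤₚ.*-cancelʳ-≡ (+ n) (+ t ℤ.+ + r ℤ.* + 2) (+ 4) (begin
  -- `e` is the cross-multiplied equation: the left fraction has denominator 2 · 4 = 8, the right
  -- one has denominator 1.
  + n ℤ.* + 4                                                          ≡⟨ arith₁ (+ n) (+ t) ⟩
  (+ n ℤ.* + 4 ℤ.+ ℤ.- (+ t ℤ.* + 2) ℤ.* + 2) ℤ.* + 1 ℤ.+ + t ℤ.* + 4  ≡⟨ cong (λ u → (+ n ℤ.* + 4 ℤ.+ ℤ.- u ℤ.* + 2) ℤ.* + 1 ℤ.+ + t ℤ.* + 4) (ℤₚ.pos-* t 2) ⟨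
  (+ n ℤ.* + 4 ℤ.+ ℤ.- + (t ℕ.* 2) ℤ.* + 2) ℤ.* + 1 ℤ.+ + t ℤ.* + 4    ≡⟨ cong (ℤ._+ + t ℤ.* + 4) e ⟩
  + r ℤ.* + 8 ℤ.+ + t ℤ.* + 4                                          ≡⟨ arith₂ (+ r) (+ t) ⟩
  (+ t ℤ.+ + r ℤ.* + 2) ℤ.* + 4                                        ∎))
  (cong (ℤ._+_ (+ t)) (sym (ℤₚ.pos-* r 2))))
  where
  open ≡-Reasoning
  arith₁ : ∀ n t → n ℤ.* + 4 ≡ (n ℤ.* + 4 ℤ.+ ℤ.- (t ℤ.* + 2) ℤ.* + 2) ℤ.* + 1 ℤ.+ t ℤ.* + 4
  arith₁ = ℤ-Solver.solve-∀
  arith₂ : ∀ r t → r ℤ.* + 8 ℤ.+ t ℤ.* + 4 ≡ (t ℤ.+ r ℤ.* + 2) ℤ.* + 4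
  arith₂ = ℤ-Solver.solve-∀

argument-≃⇐ : ∀ t r → toℚᵘ (argument (t ℕ.+ r ℕ.* 2) (t ℕ.* 2)) ≃ mkℚᵘ (+ r) 0
argument-≃⇐ t r = ℚᵘₚ.≃-trans (argument-≃ (t ℕ.+ r ℕ.* 2) (t ℕ.* 2)) (*≡* (begin
  (+ (t ℕ.+ r ℕ.* 2) ℤ.* + 4 ℤ.+ ℤ.- + (t ℕ.* 2) ℤ.* + 2) ℤ.* + 1
    ≡⟨ cong₂ (λ u v → ((+ t ℤ.+ u) ℤ.* + 4 ℤ.+ ℤ.- v ℤ.* + 2) ℤ.* + 1) (ℤₚ.pos-* r 2) (ℤₚ.pos-* t 2) ⟩
  ((+ t ℤ.+ + r ℤ.* + 2) ℤ.* + 4 ℤ.+ ℤ.- (+ t ℤ.* + 2) ℤ.* + 2) ℤ.* + 1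
    ≡⟨ arith (+ r) (+ t) ⟩
  + r ℤ.* + 8 ∎))
  where
  open ≡-Reasoning
  arith : ∀ r t → ((t ℤ.+ r ℤ.* + 2) ℤ.* + 4 ℤ.+ ℤ.- (t ℤ.* + 2) ℤ.* + 2) ℤ.* + 1 ≡ r ℤ.* + 8
  arith = ℤ-Solver.solve-∀

argument-integer : ∀ t r → argument (t ℕ.+ r ℕ.* 2) (t ℕ.* 2) ≡ mkℚ (+ r) 0 (coprime-sym (1-coprimeTo r))
argument-integer t r = ℚₚ.toℚᵘ-injective (argument-≃⇐ t r)

module _ (n t : ℕ) (f : Series) (f₀ : f 0 ≡ 0ℤ)
         (f₊ : ∀ r → suc r ≤ n → f (suc r) ≡ + totalParts (partitions (suc r))) where

  -- The argument equals r exactly when n = t + 2 r. Generalising it to `q` permits a case split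
  -- along the clauses of `S`; outside the positive integers, a nonzero coefficient would force `q`
  -- to be a positive integer.
  S≡delay : ∀ q → argument n (t ℕ.* 2) ≡ q → + S q ≡ delay 0ℤ t (dilate f) n
  S≡delay (mkℚ (+ suc r) zero    _) eq
    with refl ← argument-≃⇒ n t (suc r) (subst (λ q → toℚᵘ q ≃ mkℚᵘ (+ suc r) 0) (sym eq) (*≡* refl)) = begin
    + totalParts (partitions (suc r))               ≡⟨ f₊ r (≤-trans (m≤m*n (suc r) 2) (m≤n+m (suc r ℕ.* 2) t)) ⟨
    f (suc r)                                       ≡⟨ dilate-double f (suc r) ⟨
    dilate f (suc r ℕ.* 2)                          ≡⟨ delay-+ 0ℤ t (dilate f) (suc r ℕ.* 2) ⟨
    delay 0ℤ t (dilate f) (t ℕ.+ suc r ℕ.* 2)       ∎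
    where open ≡-Reasoning
  S≡delay (mkℚ (+ zero)  _       _) eq = sym (delay-dilate-vanish t f n f₀
    λ { r refl → contradiction (trans (sym (argument-integer t (suc r))) eq) λ () })
  S≡delay (mkℚ (+ suc _) (suc _) _) eq = sym (delay-dilate-vanish t f n f₀
    λ { r refl → contradiction (trans (sym (argument-integer t (suc r))) eq) λ () })
  S≡delay (mkℚ -[1+ _ ]  _       _) eq = sym (delay-dilate-vanish t f n f₀
    λ { r refl → contradiction (trans (sym (argument-integer t (suc r))) eq) λ () })

-- Convergence and the value of the series

open import Data.Nat.Base using (_+_; _*_)
open import Data.Rational.Base using (_/_; _-_)

corollary3p2 : ∀ (n : ℕ) → HasSum (λ k → + S (+ n / 2 - + (k * (k + 1)) / 4)) (b n)
corollary3p2 n = N , λ M N≤M → begin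
  partialSum term M                  ≡⟨ cong (partialSum term) (m+[n∸m]≡n N≤M) ⟨
  partialSum term (N ℕ.+ (M ∸ N))    ≡⟨ partialSum-stable term N term≡0 (M ∸ N) ⟩
  partialSum term N                  ≡⟨ partialSum-cong term≡ N ⟩
  partialSum summand N               ≡⟨ b-sum n ⟨
  b n                                ∎
  where
  open ≡-Reasoning
  -- The number of summands in `b-sum`; it also bounds the support of the series, since k ≥ N gives
  -- `triangle k` ≥ k > n.
  N = suc n ℕ.* 2
  f : Series
  f = total (partitionsUpTo (suc n))
  term summand : ℕ → ℤ
  term k    = + S (argument n (k ℕ.* (k ℕ.+ 1)))
  summand k = delay 0ℤ (triangle k) (dilate f) n
  term≡ : term ≗ summand
  term≡ k rewrite triangle-double k = S≡delay n (triangle k) f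
    (cong (+_ ∘ totalParts) (partitionsUpTo-stable {suc n} {0} z≤n))
    (λ r 1+r≤n → cong (+_ ∘ totalParts) (partitionsUpTo-stable (m≤n⇒m≤1+n 1+r≤n)))
    (argument n (triangle k ℕ.* 2)) refl
  term≡0 : ∀ k → N ≤ k → term k ≡ 0ℤ
  term≡0 k N≤k = trans (term≡ k) (delay-< 0ℤ (triangle k) (dilate f)
    (≤-trans (m≤m*n (suc n) 2) (≤-trans N≤k (n≤triangle k))))
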